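{- Let $V$ be a group-like set and let $\mu$ be a good measure on $2^{\mathbb{N}}$ whose clopen values set equals $V$. Let $H=\{h^*(\mu): h\in\mathrm{Homeo}(2^{\mathbb{N}})\}$ be the conjugacy class of $\mu$. Then: (a) The strong topology on $\mathrm{Full}(V)$ is Polish and stronger than the weak$^*$ topology on $\mathrm{Full}(V)$. (b) In the weak$^*$ topology, $\mathrm{Full}(V)$ is an $F_{\sigma\delta}$ subset of $\mathrm{Prob}(2^{\mathbb{N}})$. (c) In the weak$^*$ topology, $H$ is a dense $F_{\sigma\delta}$ subset of $\mathrm{Full}(V)$. (d) In the strong topology, $H$ is the unique dense $G_\delta$ conjugacy class in $\mathrm{Full}(V)$.
   Context: All measures are Borel probability measures; $2^{\mathbb{N}}$ is the Cantor space. A measure is full if it is positive on every nonempty open set; the clopen values set of $\nu$ is $\{\nu(U):U\text{ clopen}\}$. A full measure $\mu$ on $2^{\mathbb{N}}$ is good if whenever $U,W$ are clopen with $\mu(U)<\mu(W)$, there is a clopen $W'\subseteq W$ with $\mu(W')=\mu(U)$. A set $V$ is group-like if it is countably infinite, $\{0,1\}\subseteq V\subseteq[0,1]$, and $V+\mathbb{Z}$ is an additive subgroup of $\mathbb{R}$. For a homeomorphism $h$, $h^*(\mu)(B)=\mu(h^{ -1}(B))$ for Borel $B$. $\mathrm{Prob}(2^{\mathbb{N}})$ is the set of all Borel probability measures on $2^{\mathbb{N}}$ with the weak$^*$ topology (equivalently, $\mu_n\to\mu$ iff $\mu_n(U)\to\mu(U)$ for all clopen $U$). $\mathrm{Full}(V)$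 is the set of all full measures on $2^{\mathbb{N}}$ whose clopen values set is contained in $V$. The weak$^*$ topology on $\mathrm{Full}(V)$ is the subspace topology from $\mathrm{Prob}(2^{\mathbb{N}})$. The strong topology on $\mathrm{Full}(V)$ is the topology of pointwise convergence on clopen sets with respect to the discrete topology on $V$ (so $\mu_n\to\mu$ iff for each clopen $U$, $\mu_n(U)=\mu(U)$ for all large $n$). $\mathrm{Homeo}(2^{\mathbb{N}})$ acts on $\mathrm{Full}(V)$ by $(h,\nu)\mapsto h^*(\nu)$; conjugacy classes in $\mathrm{Full}(V)$ are the orbits of this action. -}

module Defs where

open import Level using (Level; 0ℓ; _⊔_) renaming (suc to lsuc)
open import Data.Bool.Base using (Bool)
open import Data.Integer.Base using (ℤ)
open import Data.List.Base using (List; _++_)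
open import Data.List.Relation.Unary.All as All using (All)
open import Data.List.Relation.Unary.All.Properties using (++⁻ˡ; ++⁻ʳ)
open import Data.Maybe.Base using (Maybe; just)
open import Data.Nat.Base as ℕ using (ℕ; zero; suc)
import Data.Nat.Properties as ℕₚ
open import Data.Product.Base using (Σ; Σ-syntax; ∃; ∃-syntax; ∃₂; _×_; _,_; proj₁; proj₂)
open import Data.Rational.Base as ℚ using (ℚ; 0ℚ; 1ℚ; ½)
import Data.Rational.Properties as ℚₚ
open import Data.Rational.Solver using (module +-*-Solver)
open import Data.Sum.Base using (inj₁; inj₂)
open import Function.Base using (_∘_)
open import Function.Bundles using (Inverse; _⇔_)
open import Relation.Binary.Bundles using (Setoid)
import Relation.Binary.Construct.On as On
open import Relation.Binary.PropositionalEquality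
  using (_≡_; _≢_; refl; sym; trans; cong; subst; _→-setoid_)
open import Relation.Nullary using (¬_)
open import Relation.Unary
  using (Pred; _∈_; _⊆_; _≐_; _∩_; ∁; ⋃; ⋂; _⊢_; _≬_; _⊥_; Satisfiable; Universal)

private
  variable
    a ℓ p q : Level

  0<½ : 0ℚ ℚ.< ½
  0<½ = ℚₚ.positive⁻¹ ½

  0<½* : ∀ {ε} → 0ℚ ℚ.< ε → 0ℚ ℚ.< ½ ℚ.* ε
  0<½* {ε} 0<ε = subst (ℚ._< ½ ℚ.* ε) (ℚₚ.*-zeroʳ ½) (ℚₚ.*-monoʳ-<-pos ½ 0<ε)

  halves : ∀ ε → ½ ℚ.* ε ℚ.+ ½ ℚ.* ε ≡ ε
  halves ε = trans (sym (ℚₚ.*-distribʳ-+ ε ½ ½)) (ℚₚ.*-identityˡ ε)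

  ∣-∣-sym : ∀ r s → ℚ.∣ r ℚ.- s ∣ ≡ ℚ.∣ s ℚ.- r ∣
  ∣-∣-sym r s = trans (sym (ℚₚ.∣-p∣≡∣p∣ (r ℚ.- s))) (cong ℚ.∣_∣
    (solve 2 (λ x y → :- (x :- y) := y :- x) refl r s))
    where open +-*-Solver

  ∣∣-∣∣-upper : ∀ r s → ℚ.∣ r ∣ ℚ.- ℚ.∣ s ∣ ℚ.≤ ℚ.∣ r ℚ.- s ∣
  ∣∣-∣∣-upper r s = begin
    ℚ.∣ r ∣ ℚ.- ℚ.∣ s ∣
      ≡⟨ cong (λ t → ℚ.∣ t ∣ ℚ.- ℚ.∣ s ∣) (solve 2 (λ x y → x := (x :- y) :+ y) refl r s) ⟩
    ℚ.∣ (r ℚ.- s) ℚ.+ s ∣ ℚ.- ℚ.∣ s ∣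
      ≤⟨ ℚₚ.+-monoˡ-≤ (ℚ.- ℚ.∣ s ∣) (ℚₚ.∣p+q∣≤∣p∣+∣q∣ (r ℚ.- s) s) ⟩
    (ℚ.∣ r ℚ.- s ∣ ℚ.+ ℚ.∣ s ∣) ℚ.- ℚ.∣ s ∣
      ≡⟨ solve 2 (λ x y → (x :+ y) :- y := x) refl ℚ.∣ r ℚ.- s ∣ ℚ.∣ s ∣ ⟩
    ℚ.∣ r ℚ.- s ∣ ∎
    where
    open ℚₚ.≤-Reasoning
    open +-*-Solver

  ∣∣-∣∣≤ : ∀ r s → ℚ.∣ ℚ.∣ r ∣ ℚ.- ℚ.∣ s ∣ ∣ ℚ.≤ ℚ.∣ r ℚ.- s ∣
  ∣∣-∣∣≤ r s with ℚₚ.∣p∣≡p∨∣p∣≡-p (ℚ.∣ r ∣ ℚ.- ℚ.∣ s ∣)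
  ... | inj₁ e = ℚₚ.≤-trans (ℚₚ.≤-reflexive e) (∣∣-∣∣-upper r s)
  ... | inj₂ e = begin
    ℚ.∣ ℚ.∣ r ∣ ℚ.- ℚ.∣ s ∣ ∣  ≡⟨ e ⟩
    ℚ.- (ℚ.∣ r ∣ ℚ.- ℚ.∣ s ∣)
      ≡⟨ solve 2 (λ x y → :- (x :- y) := y :- x) refl ℚ.∣ r ∣ ℚ.∣ s ∣ ⟩
    ℚ.∣ s ∣ ℚ.- ℚ.∣ r ∣        ≤⟨ ∣∣-∣∣-upper s r ⟩
    ℚ.∣ s ℚ.- r ∣              ≡⟨ ∣-∣-sym s r ⟩
    ℚ.∣ r ℚ.- s ∣              ∎
    where
    open ℚₚ.≤-Reasoning
    open +-*-Solver

  ∣-∣-triangle : ∀ r s t → ℚ.∣ r ℚ.- t ∣ ℚ.≤ ℚ.∣ r ℚ.- s ∣ ℚ.+ ℚ.∣ s ℚ.- t ∣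
  ∣-∣-triangle r s t = begin
    ℚ.∣ r ℚ.- t ∣
      ≡⟨ cong ℚ.∣_∣ (solve 3 (λ x y z → x :- z := (x :- y) :+ (y :- z)) refl r s t) ⟩
    ℚ.∣ (r ℚ.- s) ℚ.+ (s ℚ.- t) ∣      ≤⟨ ℚₚ.∣p+q∣≤∣p∣+∣q∣ (r ℚ.- s) (s ℚ.- t) ⟩
    ℚ.∣ r ℚ.- s ∣ ℚ.+ ℚ.∣ s ℚ.- t ∣    ∎
    where
    open ℚₚ.≤-Reasoning
    open +-*-Solver

-- Real numbers: Cauchy sequences of rationals, up to null sequences.
-- ℝ is a setoid, so every function or subset introduced below is
-- required, or is visibly, compatible with _≈_.

IsCauchy : (ℕ → ℚ) → Set
IsCauchy s = ∀ ε → 0ℚ ℚ.< ε → ∃[ N ] ∀ m n → N ℕ.≤ m → N ℕ.≤ n →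
             ℚ.∣ s m ℚ.- s n ∣ ℚ.< ε

record ℝ : Set where
  constructor real
  field
    seq    : ℕ → ℚ
    cauchy : IsCauchy seq

open ℝ public using (seq; cauchy)

infix 4 _≈_ _<_ _≤_
infixl 6 _+_ _-_
infix 8 -_

_≈_ : ℝ → ℝ → Set
x ≈ y = ∀ ε → 0ℚ ℚ.< ε → ∃[ N ] ∀ n → N ℕ.≤ n → ℚ.∣ seq x n ℚ.- seq y n ∣ ℚ.< ε

_<_ : ℝ → ℝ → Set
x < y = ∃[ δ ] (0ℚ ℚ.< δ × ∃[ N ] ∀ n → N ℕ.≤ n → seq x n ℚ.+ δ ℚ.≤ seq y n)

_≤_ : ℝ → ℝ → Set
x ≤ y = ¬ (y < x)

-- Abstract so that normalising a real never unfolds these proofs.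
abstract
  constant-cauchy : ∀ r → IsCauchy (λ _ → r)
  constant-cauchy r ε 0<ε =
    0 , λ _ _ _ _ → subst (λ t → ℚ.∣ t ∣ ℚ.< ε) (sym (ℚₚ.+-inverseʳ r)) 0<ε

  +-cauchy : ∀ x y → IsCauchy (λ n → seq x n ℚ.+ seq y n)
  +-cauchy (real s s-cauchy) (real t t-cauchy) ε 0<ε =
    let (M , hM) = s-cauchy (½ ℚ.* ε) (0<½* 0<ε)
        (N , hN) = t-cauchy (½ ℚ.* ε) (0<½* 0<ε)
    in M ℕ.⊔ N , λ m n M⊔N≤m M⊔N≤n →
      subst (ℚ.∣ (s m ℚ.+ t m) ℚ.- (s n ℚ.+ t n) ∣ ℚ.<_) (halves ε)
        (ℚₚ.≤-<-trans
          (ℚₚ.≤-trans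
            (ℚₚ.≤-reflexive (cong ℚ.∣_∣
              (solve 4 (λ x y x′ y′ → (x :+ y) :- (x′ :+ y′) := (x :- x′) :+ (y :- y′)) refl
                (s m) (t m) (s n) (t n))))
            (ℚₚ.∣p+q∣≤∣p∣+∣q∣ (s m ℚ.- s n) (t m ℚ.- t n)))
          (ℚₚ.+-mono-<
            (hM m n (ℕₚ.m⊔n≤o⇒m≤o M N M⊔N≤m) (ℕₚ.m⊔n≤o⇒m≤o M N M⊔N≤n))
            (hN m n (ℕₚ.m⊔n≤o⇒n≤o M N M⊔N≤m) (ℕₚ.m⊔n≤o⇒n≤o M N M⊔N≤n))))
    where open +-*-Solver

  neg-cauchy : ∀ x → IsCauchy (λ n → ℚ.- seq x n)
  neg-cauchy (real s s-cauchy) ε 0<ε =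
    let (N , hN) = s-cauchy ε 0<ε
    in N , λ m n N≤m N≤n → subst (ℚ._< ε)
      (trans (∣-∣-sym (s m) (s n)) (cong ℚ.∣_∣
        (solve 2 (λ y z → z :- y := (:- y) :- (:- z)) refl (s m) (s n))))
      (hN m n N≤m N≤n)
    where open +-*-Solver

  ∣∣-cauchy : ∀ x → IsCauchy (λ n → ℚ.∣ seq x n ∣)
  ∣∣-cauchy (real s s-cauchy) ε 0<ε =
    let (N , hN) = s-cauchy ε 0<ε
    in N , λ m n N≤m N≤n → ℚₚ.≤-<-trans (∣∣-∣∣≤ (s m) (s n)) (hN m n N≤m N≤n)

fromℚ : ℚ → ℝ
fromℚ r = real (λ _ → r) (constant-cauchy r)

fromℤ : ℤ → ℝ
fromℤ k = fromℚ (k ℚ./ 1)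

0ℝ 1ℝ : ℝ
0ℝ = fromℚ 0ℚ
1ℝ = fromℚ 1ℚ

_+_ : ℝ → ℝ → ℝ
x + y = real (λ n → seq x n ℚ.+ seq y n) (+-cauchy x y)

-_ : ℝ → ℝ
- x = real (λ n → ℚ.- seq x n) (neg-cauchy x)

_-_ : ℝ → ℝ → ℝ
x - y = x + (- y)

∣_∣ : ℝ → ℝ
∣ x ∣ = real (λ n → ℚ.∣ seq x n ∣) (∣∣-cauchy x)

abstract
  ≈-refl : ∀ x → x ≈ x
  ≈-refl x ε 0<ε =
    0 , λ n _ → subst (λ t → ℚ.∣ t ∣ ℚ.< ε) (sym (ℚₚ.+-inverseʳ (seq x n))) 0<ε

  ≈-sym : ∀ x y → x ≈ y → y ≈ x
  ≈-sym x y x≈y ε 0<ε =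
    let (N , hN) = x≈y ε 0<ε
    in N , λ n N≤n → subst (ℚ._< ε) (∣-∣-sym (seq x n) (seq y n)) (hN n N≤n)

  ≈-trans : ∀ x y z → x ≈ y → y ≈ z → x ≈ z
  ≈-trans x y z x≈y y≈z ε 0<ε =
    let (M , hM) = x≈y (½ ℚ.* ε) (0<½* 0<ε)
        (N , hN) = y≈z (½ ℚ.* ε) (0<½* 0<ε)
    in M ℕ.⊔ N , λ n M⊔N≤n →
      subst (ℚ.∣ seq x n ℚ.- seq z n ∣ ℚ.<_) (halves ε)
        (ℚₚ.≤-<-trans (∣-∣-triangle (seq x n) (seq y n) (seq z n))
          (ℚₚ.+-mono-< (hM n (ℕₚ.m⊔n≤o⇒m≤o M N M⊔N≤n)) (hN n (ℕₚ.m⊔n≤o⇒n≤o M N M⊔N≤n))))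

  ≈⇒∣-∣<ε : ∀ x y ε → x ≈ y → 0ℝ < ε → ∣ y - x ∣ < ε
  ≈⇒∣-∣<ε x y ε x≈y (δ , 0<δ , M , hM) =
    let (N , hN) = x≈y (½ ℚ.* δ) (0<½* 0<δ)
    in ½ ℚ.* δ , 0<½* 0<δ , M ℕ.⊔ N , λ n M⊔N≤n → begin
      ℚ.∣ seq y n ℚ.- seq x n ∣ ℚ.+ ½ ℚ.* δ
        ≡⟨ cong (ℚ._+ ½ ℚ.* δ) (∣-∣-sym (seq y n) (seq x n)) ⟩
      ℚ.∣ seq x n ℚ.- seq y n ∣ ℚ.+ ½ ℚ.* δ
        ≤⟨ ℚₚ.+-monoˡ-≤ (½ ℚ.* δ) (ℚₚ.<⇒≤ (hN n (ℕₚ.m⊔n≤o⇒n≤o M N M⊔N≤n))) ⟩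
      ½ ℚ.* δ ℚ.+ ½ ℚ.* δ  ≡⟨ halves δ ⟩
      δ                    ≡⟨ ℚₚ.+-identityˡ δ ⟨
      0ℚ ℚ.+ δ             ≤⟨ hM n (ℕₚ.m⊔n≤o⇒m≤o M N M⊔N≤n) ⟩
      seq ε n              ∎
    where open ℚₚ.≤-Reasoning

_⟶_ : (ℕ → ℝ) → ℝ → Set
x ⟶ l = ∀ ε → 0ℝ < ε → ∃[ N ] ∀ n → N ℕ.≤ n → ∣ x n - l ∣ < ε

partialSum : (ℕ → ℝ) → ℕ → ℝ
partialSum x zero    = 0ℝ
partialSum x (suc n) = partialSum x n + x n

-- The empty set is the union of the empty family.
record Topology (X : Setoid a ℓ) (p q : Level) : Set (a ⊔ ℓ ⊔ lsuc (p ⊔ q)) where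
  open Setoid X using (Carrier) renaming (_≈_ to _~_)
  field
    Open       : Pred Carrier p → Set q
    Open-resp  : ∀ {O} → Open O → ∀ {x y} → x ~ y → x ∈ O → y ∈ O
    Open-≐     : ∀ {O O′} → O ≐ O′ → Open O → Open O′
    Open-whole : ∀ {O} → Universal O → Open O
    Open-∩     : ∀ {O O′} → Open O → Open O′ → Open (O ∩ O′)
    Open-⋃     : ∀ (I : Set p) {O : I → Pred Carrier p} → (∀ i → Open (O i)) → Open (⋃ I O)

module _ {X : Setoid a ℓ} (T : Topology X p q) where
  open Setoid X using (Carrier)
  open Topology T

  Closed : Pred Carrier p → Set q
  Closed C = Open (∁ C)

  Dense : Pred Carrier p → Set (a ⊔ lsuc p ⊔ q)
  Dense D = ∀ O → Open O → Satisfiable O → O ≬ D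

  Gδ : Pred Carrier p → Set (a ⊔ lsuc p ⊔ q)
  Gδ S = Σ[ O ∈ (ℕ → Pred Carrier p) ] (∀ n → Open (O n)) × S ≐ ⋂ ℕ O

  Fσδ : Pred Carrier p → Set (a ⊔ lsuc p ⊔ q)
  Fσδ S = Σ[ C ∈ (ℕ → ℕ → Pred Carrier p) ]
    (∀ m n → Closed (C m n)) × S ≐ ⋂ ℕ (λ m → ⋃ ℕ (C m))

_FinerThan_ : ∀ {q′} {X : Setoid a ℓ} → Topology X p q → Topology X p q′ → Set (a ⊔ lsuc p ⊔ q ⊔ q′)
T FinerThan T′ = ∀ O → Topology.Open T′ O → Topology.Open T O

subsetoid : (X : Setoid a ℓ) → Pred (Setoid.Carrier X) p → Setoid (a ⊔ p) ℓ
subsetoid X S = On.setoid {B = Σ _ S} X proj₁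

subspace : {X : Setoid a ℓ} → Topology X p q →
           (S : Pred (Setoid.Carrier X) p) → Topology (subsetoid X S) p (a ⊔ lsuc p ⊔ q)
subspace T S = record
  { Open       = λ O → ∃[ O′ ] Open O′ × O ≐ (proj₁ ⊢ O′)
  ; Open-resp  = λ (_ , o , O⊆ , ⊆O) x~y x∈O → ⊆O (Open-resp o x~y (O⊆ x∈O))
  ; Open-≐     = λ (⊆′ , ′⊆) (O′ , o , O⊆ , ⊆O) → O′ , o , (O⊆ ∘ ′⊆) , (⊆′ ∘ ⊆O)
  ; Open-whole = λ u → (λ _ → Whole) , Open-whole (λ _ → whole) , (λ _ → whole) , (λ {x} _ → u x)
  ; Open-∩     = λ (A , a , A⊆ , ⊆A) (B , b , B⊆ , ⊆B) →
      A ∩ B , Open-∩ a b , (λ (x , y) → A⊆ x , B⊆ y) , (λ (x , y) → ⊆A x , ⊆B y)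
  ; Open-⋃     = λ I os → ⋃ I (λ i → proj₁ (os i)) , Open-⋃ I (λ i → proj₁ (proj₂ (os i))) ,
      (λ (i , x) → i , proj₁ (proj₂ (proj₂ (os i))) x) ,
      (λ (i , x) → i , proj₂ (proj₂ (proj₂ (os i))) x)
  }
  where
  open Topology T
  record Whole {p} : Set p where constructor whole

-- The topology in which O is open iff every x ∈ O has some N i x ⊆ O.
fromNeighbourhoods :
  (X : Setoid a ℓ) (let open Setoid X using (Carrier) renaming (_≈_ to _~_))
  {I : Set q} (N : I → Carrier → Pred Carrier p) → I →
  (∀ i {x y} → x ~ y → y ∈ N i x) →
  (∀ i j → ∃[ k ] ∀ {x} → N k x ⊆ N i x ∩ N j x) →
  Topology X p (a ⊔ p ⊔ q)
fromNeighbourhoods X {I} N i₀ N-resp directed = record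
  { Open       = λ O → ∀ {x} → x ∈ O → ∃[ i ] N i x ⊆ O
  ; Open-resp  = λ o x~y x∈O → let (i , N⊆O) = o x∈O in N⊆O (N-resp i x~y)
  ; Open-≐     = λ (⊆′ , ′⊆) o x∈O′ → let (i , N⊆O) = o (′⊆ x∈O′) in i , ⊆′ ∘ N⊆O
  ; Open-whole = λ u _ → i₀ , λ {y} _ → u y
  ; Open-∩     = λ o o′ (x∈O , x∈O′) →
      let (i , Ni⊆O) = o x∈O
          (j , Nj⊆O′) = o′ x∈O′
          (k , Nk⊆) = directed i j
      in k , λ y∈ → Ni⊆O (proj₁ (Nk⊆ y∈)) , Nj⊆O′ (proj₂ (Nk⊆ y∈))
  ; Open-⋃     = λ _ os (i , x∈O) → let (k , N⊆O) = os i x∈O in k , λ y∈ → i , N⊆O y∈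
  }

module _ (X : Setoid a ℓ) where
  open Setoid X using (Carrier) renaming (_≈_ to _~_)

  -- Nonnegativity and congruence of dist follow from these axioms.
  record Metric : Set (a ⊔ ℓ) where
    field
      dist     : Carrier → Carrier → ℝ
      dist-0   : ∀ x y → dist x y ≈ 0ℝ ⇔ x ~ y
      dist-sym : ∀ x y → dist x y ≈ dist y x
      triangle : ∀ x y z → dist x z ≤ dist x y + dist y z

  module _ (d : Metric) where
    open Metric d

    Complete : Set a
    Complete = (s : ℕ → Carrier) →
      (∀ ε → 0ℝ < ε → ∃[ N ] ∀ m n → N ℕ.≤ m → N ℕ.≤ n → dist (s m) (s n) < ε) →
      ∃[ x ] ∀ ε → 0ℝ < ε → ∃[ N ] ∀ n → N ℕ.≤ n → dist (s n) x < ε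

    MetricOpen : Pred Carrier p → Set (a ⊔ p)
    MetricOpen O = ∀ {x} → x ∈ O → ∃[ ε ] (0ℝ < ε × (λ y → dist x y < ε) ⊆ O)

-- The countable dense set is {x | s n = just x for some n}, which may be
-- empty or finite.
Separable : {X : Setoid a ℓ} → Topology X p q → Set (a ⊔ lsuc p ⊔ q)
Separable {X = X} T = Σ[ s ∈ (ℕ → Maybe Carrier) ]
  ∀ O → Open O → Satisfiable O → ∃₂ λ n x → s n ≡ just x × x ∈ O
  where
  open Setoid X using (Carrier)
  open Topology T

Polish : {X : Setoid a ℓ} → Topology X p q → Set (a ⊔ ℓ ⊔ lsuc p ⊔ q)
Polish {X = X} T = Separable T ×
  (Σ[ d ∈ Metric X ] Complete X d × (∀ O → Topology.Open T O ⇔ MetricOpen X d O))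

Cantor : Setoid 0ℓ 0ℓ
Cantor = ℕ →-setoid Bool

2^ℕ : Set
2^ℕ = Setoid.Carrier Cantor

cantorTopology : Topology Cantor 0ℓ 0ℓ
cantorTopology = fromNeighbourhoods Cantor
  (λ n x y → ∀ i → i ℕ.< n → x i ≡ y i)
  0
  (λ _ x≗y i _ → x≗y i)
  (λ m n → m ℕ.⊔ n , λ h →
    (λ i i<m → h i (ℕₚ.<-≤-trans i<m (ℕₚ.m≤m⊔n m n))) ,
    (λ i i<n → h i (ℕₚ.<-≤-trans i<n (ℕₚ.m≤n⊔m m n))))

open Topology cantorTopology using () renaming (Open to IsOpen; Open-resp to IsOpen-resp) public

IsClopen : Pred 2^ℕ 0ℓ → Set
IsClopen U = IsOpen U × Closed cantorTopology U

Clopen : Set₁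
Clopen = Σ[ U ∈ Pred 2^ℕ 0ℓ ] IsClopen U

Continuous : (2^ℕ → 2^ℕ) → Set₁
Continuous f = ∀ U → IsOpen U → IsOpen (f ⊢ U)

record Homeo : Set₁ where
  field
    inverse         : Inverse Cantor Cantor
  open Inverse inverse public using (to; from; strictlyInverseˡ)
  field
    to-continuous   : Continuous to
    from-continuous : Continuous from

-- Classically every open set is a countable union of cylinders, so
-- predicates in Set represent all Borel sets.
data Borel : Pred 2^ℕ 0ℓ → Set₁ where
  isOpen     : ∀ {B} → IsOpen B → Borel B
  complement : ∀ {B} → Borel B → Borel (∁ B)
  union      : ∀ {B : ℕ → Pred 2^ℕ 0ℓ} → (∀ n → Borel (B n)) → Borel (⋃ ℕ B)
  resp       : ∀ {B C} → B ≐ C → Borel B → Borel C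

preimage : ∀ {f} → Continuous f → ∀ {B} → Borel B → Borel (f ⊢ B)
preimage c (isOpen o)         = isOpen (c _ o)
preimage c (complement b)     = complement (preimage c b)
preimage c (union b)          = union (λ n → preimage c (b n))
preimage c (resp (⊆C , C⊆) b) = resp (⊆C , C⊆) (preimage c b)

-- By measure-≐, the measure depends neither on the presentation of a
-- Borel set as a predicate nor on the derivation that it is Borel.
record ProbabilityMeasure : Set₁ where
  field
    measure   : ∀ {B} → Borel B → ℝ
    measure-≐ : ∀ {B C} (b : Borel B) (c : Borel C) → B ≐ C → measure b ≈ measure c
    nonneg    : ∀ {B} (b : Borel B) → 0ℝ ≤ measure b
    total     : ∀ {B} (b : Borel B) → Universal B → measure b ≈ 1ℝ
    additive  : ∀ {B : ℕ → Pred 2^ℕ 0ℓ} (b : ∀ n → Borel (B n)) →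
                (∀ m n → m ≢ n → B m ⊥ B n) →
                partialSum (λ n → measure (b n)) ⟶ measure (union b)

open ProbabilityMeasure public

_⟨_⟩ : ProbabilityMeasure → Clopen → ℝ
μ ⟨ U , o , _ ⟩ = measure μ (isOpen o)

Prob : Setoid (lsuc 0ℓ) (lsuc 0ℓ)
Prob = record
  { Carrier       = ProbabilityMeasure
  ; _≈_           = λ μ ν → ∀ {B} (b : Borel B) → measure μ b ≈ measure ν b
  ; isEquivalence = record
    { refl  = λ {μ} b → ≈-refl (measure μ b)
    ; sym   = λ {μ} {ν} e b → ≈-sym (measure μ b) (measure ν b) (e b)
    ; trans = λ {μ} {ν} {ρ} e f b →
        ≈-trans (measure μ b) (measure ν b) (measure ρ b) (e b) (f b)
    }
  }

_^* : Homeo → ProbabilityMeasure → ProbabilityMeasure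
(h ^*) μ = record
  { measure   = λ b → measure μ (preimage to-continuous b)
  ; measure-≐ = λ b c (⊆C , C⊆) →
      measure-≐ μ (preimage to-continuous b) (preimage to-continuous c) (⊆C , C⊆)
  ; nonneg    = λ b → nonneg μ (preimage to-continuous b)
  ; total     = λ b u → total μ (preimage to-continuous b) (λ x → u (to x))
  ; additive  = λ b disjoint →
      additive μ (λ n → preimage to-continuous (b n)) (λ m n m≢n → disjoint m n m≢n)
  }
  where open Homeo h

-- Weak* convergence is convergence on every clopen set: the locally
-- constant functions are uniformly dense in C(2^ℕ).  A basic
-- neighbourhood of μ is given by finitely many conditions
-- ∣ν(U) − μ(U)∣ < ε, each with its own clopen U and ε > 0.
weak* : Topology Prob (lsuc 0ℓ) (lsuc 0ℓ)
weak* = fromNeighbourhoods Prob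
  {I = List (Clopen × (Σ[ ε ∈ ℝ ] 0ℝ < ε))}
  (λ i μ ν → All (λ (U , ε , _) → ∣ ν ⟨ U ⟩ - μ ⟨ U ⟩ ∣ < ε) i)
  List.[]
  (λ i {μ} {ν} μ~ν → All.universal
    (λ ((U , o , c) , ε , 0<ε) →
      ≈⇒∣-∣<ε (μ ⟨ U , o , c ⟩) (ν ⟨ U , o , c ⟩) ε (μ~ν (isOpen o)) 0<ε) i)
  (λ i j → i ++ j , λ h → ++⁻ˡ i h , ++⁻ʳ i h)

IsFull : ProbabilityMeasure → Set₁
IsFull μ = ∀ {U} (o : IsOpen U) → Satisfiable U → 0ℝ < measure μ (isOpen o)

clopenValues : ProbabilityMeasure → Pred ℝ (lsuc 0ℓ)
clopenValues μ r = Σ[ U ∈ Clopen ] r ≈ μ ⟨ U ⟩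

record IsGood (μ : ProbabilityMeasure) : Set₁ where
  field
    full : IsFull μ
    good : (U W : Clopen) → μ ⟨ U ⟩ < μ ⟨ W ⟩ →
           Σ[ W′ ∈ Clopen ] (proj₁ W′ ⊆ proj₁ W × μ ⟨ W′ ⟩ ≈ μ ⟨ U ⟩)

record IsAdditiveSubgroup (G : Pred ℝ 0ℓ) : Set where
  field
    0∈G      : 0ℝ ∈ G
    +-closed : ∀ {x y} → x ∈ G → y ∈ G → x + y ∈ G
    neg      : ∀ {x} → x ∈ G → - x ∈ G

_+ℤ : Pred ℝ 0ℓ → Pred ℝ 0ℓ
(V +ℤ) x = ∃₂ λ v k → v ∈ V × x ≈ v + fromℤ k

-- The last field also makes V closed under _≈_.
record CountablyInfinite (V : Pred ℝ 0ℓ) : Set where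
  field
    enum           : ℕ → ℝ
    enum-injective : ∀ {m n} → enum m ≈ enum n → m ≡ n
    enum-range     : V ≐ (λ x → ∃[ n ] x ≈ enum n)

record GroupLike (V : Pred ℝ 0ℓ) : Set where
  field
    countablyInfinite : CountablyInfinite V
    0∈V               : 0ℝ ∈ V
    1∈V               : 1ℝ ∈ V
    V⊆[0,1]           : V ⊆ (λ x → 0ℝ ≤ x × x ≤ 1ℝ)
    V+ℤ-subgroup      : IsAdditiveSubgroup (V +ℤ)

module _ (V : Pred ℝ 0ℓ) where

  Full : Pred ProbabilityMeasure (lsuc 0ℓ)
  Full μ = IsFull μ × clopenValues μ ⊆ V

  FullSpace : Setoid (lsuc 0ℓ) (lsuc 0ℓ)
  FullSpace = subsetoid Prob Full

  weak*Full : Topology FullSpace (lsuc 0ℓ) (lsuc (lsuc 0ℓ))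
  weak*Full = subspace weak* Full

  -- Pointwise convergence on clopen sets, with V discrete.
  strong : Topology FullSpace (lsuc 0ℓ) (lsuc 0ℓ)
  strong = fromNeighbourhoods FullSpace
    {I = List Clopen}
    (λ i (μ , _) (ν , _) → All (λ U → ν ⟨ U ⟩ ≈ μ ⟨ U ⟩) i)
    List.[]
    (λ i {(μ , _)} {(ν , _)} μ~ν → All.universal
      (λ (U , o , c) → ≈-sym (μ ⟨ U , o , c ⟩) (ν ⟨ U , o , c ⟩) (μ~ν (isOpen o))) i)
    (λ i j → i ++ j , λ h → ++⁻ˡ i h , ++⁻ʳ i h)

  act : Homeo → Setoid.Carrier FullSpace → Setoid.Carrier FullSpace
  act h (μ , full , values) = (h ^*) μ ,
    (λ {U} o (y , y∈U) → full (to-continuous U o)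
      (from y , IsOpen-resp o (λ i → sym (strictlyInverseˡ y i)) y∈U)) ,
    (λ ((U , o , c) , r≈) → values
      ((to ⊢ U , to-continuous U o , to-continuous (∁ U) c) , r≈))
    where open Homeo h

  conjugacyClass : Setoid.Carrier FullSpace → Pred (Setoid.Carrier FullSpace) (lsuc 0ℓ)
  conjugacyClass ν ν′ = ∃[ h ] Setoid._≈_ FullSpace ν′ (act h ν)

{-# OPTIONS --safe #-}
module Submission where

open import Defs
open import Level using (0ℓ; Lift; lift; lower) renaming (suc to lsuc)
open import Algebra.Bundles using (AbelianGroup)
import Algebra.Properties.AbelianGroup as AbelianGroupProperties
open import Axiom.ExcludedMiddle using (ExcludedMiddle)
open import Data.Bool.Base using (Bool; true; false; if_then_else_; _∧_; not)
import Data.Bool.Properties as 𝔹ₚ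
open import Data.Empty using (⊥; ⊥-elim)
import Data.Integer.Base as ℤ
import Data.Integer.Properties as ℤₚ
open import Data.List.Base using (List; []; _∷_; length; map; _++_)
open import Data.List.Properties using (∷-injective; ∷-injectiveʳ)
open import Data.List.Relation.Unary.All as All using (All; []; _∷_)
open import Data.List.Relation.Unary.All.Properties using (++⁻ˡ; ++⁻ʳ; map⁻)
open import Data.Maybe.Base using (Maybe; just; nothing)
open import Data.Nat.Base as ℕ using (ℕ; zero; suc)
open import Data.Nat.Coprimality using (1-coprimeTo)
import Data.Nat.Properties as ℕₚ
open import Data.Product.Base using (Σ; Σ-syntax; ∃-syntax; _×_; _,_; proj₁; proj₂; swap)
open import Data.Rational.Base as ℚ using (ℚ; mkℚ; 0ℚ; ½)
import Data.Rational.Properties as ℚₚ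
open import Data.Rational.Solver using (module +-*-Solver)
open import Data.Sum.Base using (_⊎_; inj₁; inj₂)
open import Function.Base using (_∘_; id)
open import Function.Bundles using (mk⇔; _⇔_; Inverse)
open import Relation.Binary.Bundles using (Setoid)
open import Relation.Binary.Definitions using (tri<; tri≈; tri>)
open import Relation.Binary.PropositionalEquality
  using (_≡_; _≢_; refl; sym; trans; cong; cong₂; subst)
open import Relation.Nullary using (¬_; yes; no; does)
open import Relation.Unary using (Pred; _∈_; _⊆_; _≐_; _∩_; _∪_; ∁; ⋃) renaming (_⊥_ to _⟂_)

-- Call ν homogeneous if for all clopen W and all v ∈ V with v < ν(W) some clopen
-- W′ ⊆ W has measure v. A good measure with clopen values V is homogeneous, and
-- two homogeneous measures in Full(V) are conjugate: a back-and-forth argument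
-- builds two matching trees of clopen sets with equal measures, and matching
-- branches defines a homeomorphism. Hence H consists of the homogeneous measures
-- in Full(V). As the clopen sets and V are countable, homogeneity is a countable
-- conjunction of countable disjunctions of conditions on single clopen sets,
-- which gives the Borel complexity of H.
--
-- For a finitely additive positive m on clopen sets with values in V, homogeneity
-- of μ allows one to carve clopen sets W_s with μ(W_s) = m[s] along the binary
-- tree; then m is the image of μ under the continuous map that sends W_s into the
-- cylinder [s]. This replaces Carathéodory's extension theorem and makes the
-- strong topology complete. If the first n levels of the tree are prescribed by
-- the W_s and then continued by a back-and-forth argument that only keeps track
-- of emptiness, the map becomes a homeomorphism; so H is dense. Finally, two dense
-- Gδ classes meet by the Baire category argument.

-- Real numbers

-- A limit in the strong topology is known only on clopen sets, and its countable additivity has to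
-- come from somewhere. A pushforward inherits it from `μ`, because preimages commute with countable
-- unions; this is why even completeness of the strong topology rests on the homogeneity of `μ`.
--
-- For density the obstacle is that a measure `ν` in Full(V) need not be homogeneous: `μ` can be
-- carved to imitate `ν`, but not conversely, so masses cannot be matched in both directions all the
-- way down. A strong neighbourhood of `ν` constrains only finitely many clopen sets, hence only
-- finitely many levels of the tree. Below them the homeomorphism is free, and any two nonempty
-- clopen sets can be split alike because Cantor space has no isolated points.

0<½* : ∀ {ε} → 0ℚ ℚ.< ε → 0ℚ ℚ.< ½ ℚ.* ε
0<½* {ε} 0<ε = subst (ℚ._< ½ ℚ.* ε) (ℚₚ.*-zeroʳ ½) (ℚₚ.*-monoʳ-<-pos ½ 0<ε)

-- An inequality p ≤ q follows from r ≤ s when q - p ≡ s - r; the equation is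
-- left to the ring solver.
≤-by : ∀ {p q r s} → r ℚ.≤ s → p ℚ.+ s ≡ q ℚ.+ r → p ℚ.≤ q
≤-by {p} {q} {r} {s} r≤s e with q ℚₚ.<? p
... | no q≮p = ℚₚ.≮⇒≥ q≮p
... | yes q<p = ⊥-elim (ℚₚ.<-irrefl (sym e) (ℚₚ.+-mono-<-≤ q<p r≤s))

<-by : ∀ {p q r s} → r ℚ.< s → p ℚ.+ s ≡ q ℚ.+ r → p ℚ.< q
<-by {p} {q} {r} {s} r<s e with q ℚₚ.≤? p
... | no q≰p = ℚₚ.≰⇒> q≰p
... | yes q≤p = ⊥-elim (ℚₚ.<-irrefl (sym e) (ℚₚ.+-mono-≤-< q≤p r<s))

p<p+d : ∀ p {d} → 0ℚ ℚ.< d → p ℚ.< p ℚ.+ d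
p<p+d p {d} 0<d = subst (ℚ._< p ℚ.+ d) (ℚₚ.+-identityʳ p) (ℚₚ.+-monoʳ-< p 0<d)

p+d≰p : ∀ p {d} → 0ℚ ℚ.< d → ¬ (p ℚ.+ d ℚ.≤ p)
p+d≰p p 0<d h = ℚₚ.<-irrefl refl (ℚₚ.<-≤-trans (p<p+d p 0<d) h)

-- The relations of ℝ are wrapped in records because they unfold to the
-- underlying sequences, from which Agda cannot infer the two reals.
infix 4 _≃_ _≺_

record _≃_ (x y : ℝ) : Set where
  constructor ≈⇒≃
  field ≃⇒≈ : x ≈ y
open _≃_ public

record _≺_ (x y : ℝ) : Set where
  constructor <⇒≺
  field ≺⇒< : x < y
open _≺_ public

abstract
  ≡⇒≃ : ∀ {x y} → (∀ n → seq x n ≡ seq y n) → x ≃ y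
  ≡⇒≃ {x} {y} e = ≈⇒≃ λ ε 0<ε → 0 , λ n _ →
    subst (ℚ._< ε) (sym (trans (cong (λ t → ℚ.∣ t ℚ.- seq y n ∣) (e n))
      (cong ℚ.∣_∣ (ℚₚ.+-inverseʳ (seq y n))))) 0<ε

  ≃-refl : ∀ {x} → x ≃ x
  ≃-refl {x} = ≈⇒≃ (≈-refl x)

  ≃-sym : ∀ {x y} → x ≃ y → y ≃ x
  ≃-sym {x} {y} (≈⇒≃ p) = ≈⇒≃ (≈-sym x y p)

  ≃-trans : ∀ {x y z} → x ≃ y → y ≃ z → x ≃ z
  ≃-trans {x} {y} {z} (≈⇒≃ p) (≈⇒≃ q) = ≈⇒≃ (≈-trans x y z p q)

  +-cong : ∀ {x y u v} → x ≃ y → u ≃ v → x + u ≃ y + v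
  +-cong {x} {y} {u} {v} (≈⇒≃ p) (≈⇒≃ q) = ≈⇒≃ λ ε 0<ε →
    let (M , hM) = p (½ ℚ.* ε) (0<½* 0<ε)
        (N , hN) = q (½ ℚ.* ε) (0<½* 0<ε)
    in M ℕ.⊔ N , λ n h → ℚₚ.≤-<-trans
        (ℚₚ.≤-trans
          (ℚₚ.≤-reflexive (cong ℚ.∣_∣
            (solve 4 (λ x y u v → (x :+ u) :- (y :+ v) := (x :- y) :+ (u :- v)) refl
              (seq x n) (seq y n) (seq u n) (seq v n))))
          (ℚₚ.∣p+q∣≤∣p∣+∣q∣ (seq x n ℚ.- seq y n) (seq u n ℚ.- seq v n)))
        (<-by (ℚₚ.+-mono-< (hM n (ℕₚ.m⊔n≤o⇒m≤o M N h)) (hN n (ℕₚ.m⊔n≤o⇒n≤o M N h)))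
          (solve 3 (λ e a b → (a :+ b) :+ (con ½ :* e :+ con ½ :* e) := e :+ (a :+ b)) refl
            ε ℚ.∣ seq x n ℚ.- seq y n ∣ ℚ.∣ seq u n ℚ.- seq v n ∣))
    where open +-*-Solver

  neg-cong : ∀ {x y} → x ≃ y → - x ≃ - y
  neg-cong {x} {y} (≈⇒≃ p) = ≈⇒≃ λ ε 0<ε →
    let (N , hN) = p ε 0<ε
    in N , λ n h → subst (ℚ._< ε)
      (trans (sym (ℚₚ.∣-p∣≡∣p∣ (seq x n ℚ.- seq y n))) (cong ℚ.∣_∣
        (solve 2 (λ x y → :- (x :- y) := (:- x) :- (:- y)) refl (seq x n) (seq y n))))
      (hN n h)
    where open +-*-Solver

ℝ-abelianGroup : AbelianGroup 0ℓ 0ℓ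
ℝ-abelianGroup = record
  { Carrier = ℝ ; _≈_ = _≃_ ; _∙_ = _+_ ; ε = 0ℝ ; _⁻¹ = -_
  ; isAbelianGroup = record
    { isGroup = record
      { isMonoid = record
        { isSemigroup = record
          { isMagma = record
            { isEquivalence = record { refl = ≃-refl ; sym = ≃-sym ; trans = ≃-trans }
            ; ∙-cong = +-cong }
          ; assoc = λ x y z → ≡⇒≃ λ n → ℚₚ.+-assoc (seq x n) (seq y n) (seq z n) }
        ; identity = (λ x → ≡⇒≃ λ n → ℚₚ.+-identityˡ (seq x n))
                   , (λ x → ≡⇒≃ λ n → ℚₚ.+-identityʳ (seq x n)) }
      ; inverse = (λ x → ≡⇒≃ λ n → ℚₚ.+-inverseˡ (seq x n))
                , (λ x → ≡⇒≃ λ n → ℚₚ.+-inverseʳ (seq x n))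
      ; ⁻¹-cong = neg-cong }
    ; comm = λ x y → ≡⇒≃ λ n → ℚₚ.+-comm (seq x n) (seq y n) } }

open AbelianGroup ℝ-abelianGroup public using ()
  renaming (identityˡ to +-identityˡ; identityʳ to +-identityʳ)

private
  module Properties = AbelianGroupProperties ℝ-abelianGroup

+-cancelˡ : ∀ x {y z} → x + y ≃ x + z → y ≃ z
+-cancelˡ x = Properties.∙-cancelˡ x _ _

-- Order and limits of real numbers

private
  halves : ∀ ε → ε ≡ ½ ℚ.* ε ℚ.+ ½ ℚ.* ε
  halves ε = trans (sym (ℚₚ.*-identityˡ ε)) (ℚₚ.*-distribʳ-+ ε ½ ½)

  quarter : ℚ → ℚ
  quarter ε = ½ ℚ.* (½ ℚ.* ε)

  quarters : ∀ ε → ε ≡ (quarter ε ℚ.+ quarter ε) ℚ.+ (quarter ε ℚ.+ quarter ε)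
  quarters ε = trans (halves ε) (cong₂ ℚ._+_ (halves (½ ℚ.* ε)) (halves (½ ℚ.* ε)))

  0<quarter : ∀ {ε} → 0ℚ ℚ.< ε → 0ℚ ℚ.< quarter ε
  0<quarter 0<ε = 0<½* (0<½* 0<ε)

  p≤∣p∣ : ∀ p → p ℚ.≤ ℚ.∣ p ∣
  p≤∣p∣ p with ℚₚ.≤-total 0ℚ p
  ... | inj₁ 0≤p = ℚₚ.≤-reflexive (sym (ℚₚ.0≤p⇒∣p∣≡p 0≤p))
  ... | inj₂ p≤0 = ℚₚ.≤-trans p≤0 (ℚₚ.0≤∣p∣ p)

  q-p≤∣p-q∣ : ∀ p q → q ℚ.- p ℚ.≤ ℚ.∣ p ℚ.- q ∣
  q-p≤∣p-q∣ p q = ℚₚ.≤-trans (p≤∣p∣ (q ℚ.- p)) (ℚₚ.≤-reflexive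
    (trans (cong ℚ.∣_∣ (solve 2 (λ p q → q :- p := :- (p :- q)) refl p q)) (ℚₚ.∣-p∣≡∣p∣ (p ℚ.- q))))
    where open +-*-Solver

abstract
  ≺-respʳ : ∀ {x y z} → y ≃ z → x ≺ y → x ≺ z
  ≺-respʳ {x} {y} {z} (≈⇒≃ p) (<⇒≺ (δ , 0<δ , N , hN)) =
    let (M , hM) = p (½ ℚ.* δ) (0<½* 0<δ)
    in <⇒≺ (½ ℚ.* δ , 0<½* 0<δ , M ℕ.⊔ N , λ n h →
      ≤-by (ℚₚ.+-mono-≤ (hN n (ℕₚ.m⊔n≤o⇒n≤o M N h))
             (ℚₚ.≤-trans (p≤∣p∣ (seq y n ℚ.- seq z n)) (ℚₚ.<⇒≤ (hM n (ℕₚ.m⊔n≤o⇒m≤o M N h)))))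
        (solve 4 (λ x y z d → (x :+ con ½ :* d) :+ (y :+ con ½ :* d) := z :+ ((x :+ d) :+ (y :- z))) refl
          (seq x n) (seq y n) (seq z n) δ))
    where open +-*-Solver

  ≺-respˡ : ∀ {x y z} → x ≃ z → x ≺ y → z ≺ y
  ≺-respˡ {x} {y} {z} (≈⇒≃ p) (<⇒≺ (δ , 0<δ , N , hN)) =
    let (M , hM) = p (½ ℚ.* δ) (0<½* 0<δ)
    in <⇒≺ (½ ℚ.* δ , 0<½* 0<δ , M ℕ.⊔ N , λ n h →
      ≤-by (ℚₚ.+-mono-≤ (hN n (ℕₚ.m⊔n≤o⇒n≤o M N h))
             (ℚₚ.≤-trans (q-p≤∣p-q∣ (seq x n) (seq z n)) (ℚₚ.<⇒≤ (hM n (ℕₚ.m⊔n≤o⇒m≤o M N h)))))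
        (solve 4 (λ x y z d → (z :+ con ½ :* d) :+ (y :+ con ½ :* d) := y :+ ((x :+ d) :+ (z :- x))) refl
          (seq x n) (seq y n) (seq z n) δ))
    where open +-*-Solver

  ≺-trans : ∀ {x y z} → x ≺ y → y ≺ z → x ≺ z
  ≺-trans {x} {y} {z} (<⇒≺ (δ , 0<δ , N , hN)) (<⇒≺ (η , 0<η , M , hM)) =
    <⇒≺ (δ , 0<δ , M ℕ.⊔ N , λ n h →
      ℚₚ.≤-trans (hN n (ℕₚ.m⊔n≤o⇒n≤o M N h)) (ℚₚ.≤-trans
        (ℚₚ.<⇒≤ (p<p+d (seq y n) 0<η))
        (hM n (ℕₚ.m⊔n≤o⇒m≤o M N h))))

  ≺-irrefl : ∀ {x y} → x ≃ y → ¬ (x ≺ y)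
  ≺-irrefl {x} {y} x≃y x≺y = irrefl (≺-respˡ x≃y x≺y)
    where
    irrefl : ¬ (y ≺ y)
    irrefl (<⇒≺ (δ , 0<δ , N , hN)) = p+d≰p (seq y N) 0<δ (hN N ℕₚ.≤-refl)

  ≺-asym : ∀ {x y} → x ≺ y → ¬ (y ≺ x)
  ≺-asym x≺y y≺x = ≺-irrefl ≃-refl (≺-trans x≺y y≺x)

  +-monoʳ-≺ : ∀ x {y z} → y ≺ z → x + y ≺ x + z
  +-monoʳ-≺ x {y} {z} (<⇒≺ (δ , 0<δ , N , hN)) = <⇒≺ (δ , 0<δ , N , λ n h →
    ≤-by (hN n h) (solve 4 (λ x y z d → ((x :+ y) :+ d) :+ z := (x :+ z) :+ (y :+ d)) refl
      (seq x n) (seq y n) (seq z n) δ))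
    where open +-*-Solver

  fromℚ-mono : ∀ {p q} → p ℚ.< q → fromℚ p ≺ fromℚ q
  fromℚ-mono {p} {q} p<q = <⇒≺ (q ℚ.- p ,
    subst (ℚ._< q ℚ.- p) (ℚₚ.+-inverseʳ p) (ℚₚ.+-monoˡ-< (ℚ.- p) p<q) , 0 , λ n _ →
    ℚₚ.≤-reflexive (solve 2 (λ p q → p :+ (q :- p) := q) refl p q))
    where open +-*-Solver

  fromℚ-cancel : ∀ {p q} → fromℚ p ≺ fromℚ q → p ℚ.< q
  fromℚ-cancel {p} {q} (<⇒≺ (δ , 0<δ , N , h)) = ℚₚ.<-≤-trans (p<p+d p 0<δ) (h N ℕₚ.≤-refl)

  rational-below : ∀ {x} → 0ℝ ≺ x → ∃[ δ ] (0ℚ ℚ.< δ × fromℚ δ ≺ x)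
  rational-below {x} (<⇒≺ (δ , 0<δ , N , hN)) =
    ½ ℚ.* δ , 0<½* 0<δ , <⇒≺ (½ ℚ.* δ , 0<½* 0<δ , N , λ n h →
      ℚₚ.≤-trans (ℚₚ.≤-reflexive (trans (sym (halves δ)) (sym (ℚₚ.+-identityˡ δ)))) (hN n h))

  -- On a Cauchy pair, x ≉ y already separates the reals by a definite gap.
  ≮⇒≃ : ∀ {x y} → ¬ (x ≺ y) → ¬ (y ≺ x) → x ≃ y
  ≮⇒≃ {x} {y} x⊀y y⊀x = ≈⇒≃ λ ε 0<ε →
    let q = quarter ε
        (M , hM) = cauchy x q (0<quarter 0<ε)
        (N , hN) = cauchy y q (0<quarter 0<ε)
    in M ℕ.⊔ N , λ n h → compare ε q (0<quarter 0<ε) (quarters ε) (M ℕ.⊔ N) n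
         (λ m h′ → hM m n (ℕₚ.m⊔n≤o⇒m≤o M N h′) (ℕₚ.m⊔n≤o⇒m≤o M N h))
         (λ m h′ → hN m n (ℕₚ.m⊔n≤o⇒n≤o M N h′) (ℕₚ.m⊔n≤o⇒n≤o M N h))
    where
    open +-*-Solver
    gap : ∀ q → 0ℚ ℚ.< q → ∀ K u v n → (q ℚ.+ q) ℚ.+ (q ℚ.+ q) ℚ.≤ seq u n ℚ.- seq v n →
      (∀ m → K ℕ.≤ m → ℚ.∣ seq u m ℚ.- seq u n ∣ ℚ.< q) →
      (∀ m → K ℕ.≤ m → ℚ.∣ seq v m ℚ.- seq v n ∣ ℚ.< q) → v ≺ u
    gap q 0<q K u v n h hu hv = <⇒≺ (q ℚ.+ q , ℚₚ.+-mono-< 0<q 0<q , K , λ m K≤m →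
      ≤-by (ℚₚ.+-mono-≤ h (ℚₚ.+-mono-≤
             (ℚₚ.≤-trans (q-p≤∣p-q∣ (seq u m) (seq u n)) (ℚₚ.<⇒≤ (hu m K≤m)))
             (ℚₚ.≤-trans (p≤∣p∣ (seq v m ℚ.- seq v n)) (ℚₚ.<⇒≤ (hv m K≤m)))))
        (solve 5 (λ q a b a′ b′ →
           (b′ :+ (q :+ q)) :+ ((a :- b) :+ (q :+ q))
           := a′ :+ (((q :+ q) :+ (q :+ q)) :+ ((a :- a′) :+ (b′ :- b)))) refl
           q (seq u n) (seq v n) (seq u m) (seq v m)))
    compare : ∀ ε q → 0ℚ ℚ.< q → ε ≡ (q ℚ.+ q) ℚ.+ (q ℚ.+ q) → ∀ K n →
      (∀ m → K ℕ.≤ m → ℚ.∣ seq x m ℚ.- seq x n ∣ ℚ.< q) →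
      (∀ m → K ℕ.≤ m → ℚ.∣ seq y m ℚ.- seq y n ∣ ℚ.< q) →
      ℚ.∣ seq x n ℚ.- seq y n ∣ ℚ.< ε
    compare ε q 0<q refl K n hx hy
      with ℚ.∣ seq x n ℚ.- seq y n ∣ ℚₚ.<? ε | ℚₚ.∣p∣≡p∨∣p∣≡-p (seq x n ℚ.- seq y n)
    ... | yes p | _ = p
    ... | no p | inj₁ e = ⊥-elim (y⊀x (gap q 0<q K x y n (subst (ε ℚ.≤_) e (ℚₚ.≮⇒≥ p)) hx hy))
    ... | no p | inj₂ e = ⊥-elim (x⊀y (gap q 0<q K y x n (subst (ε ℚ.≤_)
        (trans e (solve 2 (λ x y → :- (x :- y) := y :- x) refl (seq x n) (seq y n))) (ℚₚ.≮⇒≥ p)) hy hx))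

  private
    close : ∀ {x y ε} → ∣ y - x ∣ < fromℚ (½ ℚ.* ε) →
      ∃[ N ] ∀ n → N ℕ.≤ n → ℚ.∣ seq y n ℚ.- seq x n ∣ ℚ.≤ ½ ℚ.* ε
    close {x} {y} {ε} (δ , 0<δ , N , hN) = N , λ n h → ℚₚ.≤-trans
      (ℚₚ.<⇒≤ (p<p+d ℚ.∣ seq y n ℚ.- seq x n ∣ 0<δ)) (hN n h)

  ≺-nearʳ : ∀ {v x} → v ≺ x → ∃[ ε ] (0ℝ < ε × ∀ {y} → ∣ y - x ∣ < ε → v ≺ y)
  ≺-nearʳ {v} {x} (<⇒≺ (δ , 0<δ , N , hN)) = fromℚ (½ ℚ.* δ) , ≺⇒< (fromℚ-mono (0<½* 0<δ)) , λ {y} near →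
    let (M , hM) = close {x} {y} {δ} near in <⇒≺ (½ ℚ.* δ , 0<½* 0<δ , M ℕ.⊔ N , λ n h →
      ≤-by (ℚₚ.+-mono-≤ (hN n (ℕₚ.m⊔n≤o⇒n≤o M N h))
             (ℚₚ.≤-trans (q-p≤∣p-q∣ (seq y n) (seq x n)) (hM n (ℕₚ.m⊔n≤o⇒m≤o M N h))))
        (solve 4 (λ v x y d → (v :+ con ½ :* d) :+ (x :+ con ½ :* d) := y :+ ((v :+ d) :+ (x :- y))) refl
          (seq v n) (seq x n) (seq y n) δ))
    where open +-*-Solver

  ≺-nearˡ : ∀ {v x} → x ≺ v → ∃[ ε ] (0ℝ < ε × ∀ {y} → ∣ y - x ∣ < ε → y ≺ v)
  ≺-nearˡ {v} {x} (<⇒≺ (δ , 0<δ , N , hN)) = fromℚ (½ ℚ.* δ) , ≺⇒< (fromℚ-mono (0<½* 0<δ)) , λ {y} near →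
    let (M , hM) = close {x} {y} {δ} near in <⇒≺ (½ ℚ.* δ , 0<½* 0<δ , M ℕ.⊔ N , λ n h →
      ≤-by (ℚₚ.+-mono-≤ (hN n (ℕₚ.m⊔n≤o⇒n≤o M N h))
             (ℚₚ.≤-trans (p≤∣p∣ (seq y n ℚ.- seq x n)) (hM n (ℕₚ.m⊔n≤o⇒m≤o M N h))))
        (solve 4 (λ v x y d → (y :+ con ½ :* d) :+ (v :+ con ½ :* d) := v :+ ((x :+ d) :+ (y :- x))) refl
          (seq v n) (seq x n) (seq y n) δ))
    where open +-*-Solver

  -- Two termwise equal sequences are allowed because the partial sums of two measures agree only up
  -- to `≃`.
  lim-unique : ∀ (x y : ℕ → ℝ) {l m} → (∀ n → x n ≃ y n) → x ⟶ l → y ⟶ m → l ≃ m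
  lim-unique x y x≃y x⟶l y⟶m =
    ≮⇒≃ (apart {x} {y} x≃y x⟶l y⟶m) (apart {y} {x} (λ n → ≃-sym (x≃y n)) y⟶m x⟶l)
    where
    open +-*-Solver
    apart : ∀ {x y : ℕ → ℝ} {l m} → (∀ n → x n ≃ y n) → x ⟶ l → y ⟶ m → ¬ (l ≺ m)
    apart {x} {y} {l} {m} x≃y x⟶l y⟶m (<⇒≺ (δ , 0<δ , N , hN)) =
      -- The passages from `m` to `y k`, on to `x k` and on to `l` cost at most a quarter of the gap
      -- each; the remaining quarter is the contradiction.
      let ε = quarter δ
          0<ε = 0<quarter 0<δ
          (A , hA) = x⟶l (fromℚ ε) (≺⇒< (fromℚ-mono 0<ε))
          (B , hB) = y⟶m (fromℚ ε) (≺⇒< (fromℚ-mono 0<ε))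
          k = A ℕ.⊔ B
          (C , hC) = close {l} {x k} {½ ℚ.* δ} (hA k (ℕₚ.m≤m⊔n A B))
          (D , hD) = close {m} {y k} {½ ℚ.* δ} (hB k (ℕₚ.m≤n⊔m A B))
          (E , hE) = ≃⇒≈ (x≃y k) ε 0<ε
          n = N ℕ.⊔ (C ℕ.⊔ (D ℕ.⊔ E))
          N≤n = ℕₚ.m≤m⊔n N (C ℕ.⊔ (D ℕ.⊔ E))
          C≤n = ℕₚ.≤-trans (ℕₚ.m≤m⊔n C (D ℕ.⊔ E)) (ℕₚ.m≤n⊔m N (C ℕ.⊔ (D ℕ.⊔ E)))
          DE≤n = ℕₚ.≤-trans (ℕₚ.m≤n⊔m C (D ℕ.⊔ E)) (ℕₚ.m≤n⊔m N (C ℕ.⊔ (D ℕ.⊔ E)))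
          D≤n = ℕₚ.≤-trans (ℕₚ.m≤m⊔n D E) DE≤n
          E≤n = ℕₚ.≤-trans (ℕₚ.m≤n⊔m D E) DE≤n
      in absurd δ ε 0<ε (quarters δ) (seq l n) (seq m n) (seq (x k) n) (seq (y k) n)
           (hN n N≤n) (hC n C≤n) (hD n D≤n) (ℚₚ.<⇒≤ (hE n E≤n))
      where
      absurd : ∀ δ q → 0ℚ ℚ.< q → δ ≡ (q ℚ.+ q) ℚ.+ (q ℚ.+ q) → ∀ l m x y →
        l ℚ.+ δ ℚ.≤ m → ℚ.∣ x ℚ.- l ∣ ℚ.≤ q → ℚ.∣ y ℚ.- m ∣ ℚ.≤ q → ℚ.∣ x ℚ.- y ∣ ℚ.≤ q → ⊥
      absurd δ q 0<q refl l m x y h₁ h₂ h₃ h₄ = p+d≰p m 0<q (≤-by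
        (ℚₚ.+-mono-≤ h₁ (ℚₚ.+-mono-≤ (ℚₚ.≤-trans (p≤∣p∣ (x ℚ.- l)) h₂)
          (ℚₚ.+-mono-≤ (ℚₚ.≤-trans (q-p≤∣p-q∣ y m) h₃) (ℚₚ.≤-trans (q-p≤∣p-q∣ x y) h₄))))
        (solve 5 (λ l m x y q →
           (m :+ q) :+ (m :+ (q :+ (q :+ q)))
           := m :+ ((l :+ ((q :+ q) :+ (q :+ q))) :+ ((x :- l) :+ ((m :- y) :+ (y :- x))))) refl
           l m x y q))

  eventually-constant : ∀ {x : ℕ → ℝ} {c} N → (∀ n → N ℕ.≤ n → x n ≃ c) → x ⟶ c
  eventually-constant {x} {c} N h ε 0<ε = N , λ n N≤n →
    ≈⇒∣-∣<ε c (x n) ε (≃⇒≈ (≃-sym (h n N≤n))) 0<ε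

  lim-shift : ∀ (x : ℕ → ℝ) {l} → x ⟶ l → (λ n → x (suc n)) ⟶ l
  lim-shift x x⟶l ε 0<ε = let (N , h) = x⟶l ε 0<ε in N , λ n N≤n → h (suc n) (ℕₚ.m≤n⇒m≤1+n N≤n)

  lim-+ : ∀ (x : ℕ → ℝ) {l} a → x ⟶ l → (λ n → x n + a) ⟶ (l + a)
  lim-+ x {l} a x⟶l ε 0<ε =
    let (N , h) = x⟶l ε 0<ε
    in N , λ n N≤n →
      let (δ , 0<δ , M , hM) = h n N≤n
      in δ , 0<δ , M , λ k M≤k → subst (λ t → ℚ.∣ t ∣ ℚ.+ δ ℚ.≤ seq ε k)
           (solve 3 (λ x l a → x :- l := (x :+ a) :- (l :+ a)) refl (seq (x n) k) (seq l k) (seq a k))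
           (hM k M≤k)
    where open +-*-Solver

-- Clopen sets as locally constant Boolean functions

-- Cantor's walk through the pairs, one antidiagonal after the other.
nextPair : ℕ × ℕ → ℕ × ℕ
nextPair (zero  , b) = suc b , zero
nextPair (suc a , b) = a , suc b

unpair : ℕ → ℕ × ℕ
unpair zero    = zero , zero
unpair (suc n) = nextPair (unpair n)

unpair-surjective : ∀ a b → ∃[ n ] unpair n ≡ (a , b)
unpair-surjective a b = onDiagonal (a ℕ.+ b) b a refl
  where
  onDiagonal : ∀ s b a → a ℕ.+ b ≡ s → ∃[ n ] unpair n ≡ (a , b)
  onDiagonal zero    zero    zero    _ = zero , refl
  onDiagonal (suc s) zero    (suc a) e =
    let (n , h) = onDiagonal s s zero refl
    in suc n , trans (cong nextPair h)
         (cong (_, zero) (trans (sym e) (ℕₚ.+-identityʳ (suc a))))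
  onDiagonal s       (suc b) a       e =
    let (n , h) = onDiagonal s b (suc a) (trans (sym (ℕₚ.+-suc a b)) e)
    in suc n , cong nextPair h

infix 4 _≈[_]_
_≈[_]_ : 2^ℕ → ℕ → 2^ℕ → Set
x ≈[ n ] y = ∀ i → i ℕ.< n → x i ≡ y i

≈[]-weaken : ∀ {x y m n} → m ℕ.≤ n → x ≈[ n ] y → x ≈[ m ] y
≈[]-weaken m≤n h i i<m = h i (ℕₚ.<-≤-trans i<m m≤n)

infixr 5 _∷∞_
_∷∞_ : Bool → 2^ℕ → 2^ℕ
(b ∷∞ x) zero    = b
(b ∷∞ x) (suc i) = x i

LocallyConstant : (2^ℕ → Bool) → Set
LocallyConstant f = ∀ x → ∃[ n ] ∀ y → x ≈[ n ] y → f x ≡ f y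

UniformlyConstant : (2^ℕ → Bool) → ℕ → Set
UniformlyConstant f n = ∀ x y → x ≈[ n ] y → f x ≡ f y

private
  uniform-children : ∀ (f : 2^ℕ → Bool) → LocallyConstant f →
    (∀ b → ∃[ n ] UniformlyConstant (f ∘ (b ∷∞_)) n) → ∃[ n ] UniformlyConstant f n
  uniform-children f lc h = suc n , uniform
    where
    n = proj₁ (h true) ℕ.⊔ proj₁ (h false)
    child≤n : ∀ b → proj₁ (h b) ℕ.≤ n
    child≤n true  = ℕₚ.m≤m⊔n _ _
    child≤n false = ℕₚ.m≤n⊔m (proj₁ (h true)) _
    rebuild : ∀ x b → x 0 ≡ b → ∀ i → x i ≡ (b ∷∞ (x ∘ suc)) i
    rebuild x b e zero    = e
    rebuild x b e (suc i) = refl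
    uniform : UniformlyConstant f (suc n)
    -- `x` agrees with `x 0 ∷∞ (x ∘ suc)` only pointwise; local constancy of `f` at `x` carries the
    -- value across, and likewise at `y`.
    uniform x y x≈y = trans (proj₂ (lc x) _ (λ i _ → rebuild x (x 0) refl i))
      (trans (proj₂ (h (x 0)) (x ∘ suc) (y ∘ suc)
               (≈[]-weaken (child≤n (x 0)) (λ i i<n → x≈y (suc i) (ℕ.s≤s i<n))))
             (sym (proj₂ (lc y) _ (λ i _ → rebuild y (x 0) (sym (x≈y 0 (ℕ.s≤s ℕ.z≤n))) i))))

lc-∷∞ : ∀ {f} b → LocallyConstant f → LocallyConstant (f ∘ (b ∷∞_))
lc-∷∞ b lc x = let (n , h) = lc (b ∷∞ x) in n , λ y x≈y → h (b ∷∞ y) (agree n x≈y)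
  where
  agree : ∀ n {y} → x ≈[ n ] y → (b ∷∞ x) ≈[ n ] (b ∷∞ y)
  agree n h zero    _    = refl
  agree n h (suc i) i<n = h i (ℕₚ.<-trans (ℕₚ.n<1+n i) i<n)

-- Unlike `Clopen`, this type lies in `Set` and membership is a Boolean, so clopen sets can be
-- combined by computation and enumerated.
record Cl : Set where
  constructor mkCl
  field
    χ                : 2^ℕ → Bool
    locallyConstant  : LocallyConstant χ

open Cl public

infix 4 _≗ᶜ_ _⊑_
infixr 7 _∩ᶜ_
infixl 7 _∖ᶜ_

_≗ᶜ_ _⊑_ : Cl → Cl → Set
a ≗ᶜ b = ∀ x → χ a x ≡ χ b x
a ⊑ b = ∀ x → χ a x ≡ true → χ b x ≡ true

Nonempty : Cl → Set
Nonempty a = ∃[ x ] χ a x ≡ true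

χ-resp : ∀ a {x y} → (∀ i → x i ≡ y i) → χ a x ≡ χ a y
χ-resp a {x} {y} e = proj₂ (locallyConstant a x) y (λ i _ → e i)

map₂ᶜ : (Bool → Bool → Bool) → Cl → Cl → Cl
map₂ᶜ g (mkCl f lc) (mkCl f′ lc′) = mkCl (λ x → g (f x) (f′ x)) λ x →
  let (m , h) = lc x
      (n , h′) = lc′ x
  in m ℕ.⊔ n , λ y e → cong₂ g (h y (≈[]-weaken (ℕₚ.m≤m⊔n m n) e)) (h′ y (≈[]-weaken (ℕₚ.m≤n⊔m m n) e))

_∩ᶜ_ _∖ᶜ_ : Cl → Cl → Cl
_∩ᶜ_ = map₂ᶜ _∧_
_∖ᶜ_ = map₂ᶜ (λ b c → b ∧ not c)

⊤ᶜ : Cl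
⊤ᶜ = mkCl (λ _ → true) (λ _ → 0 , λ _ _ → refl)

∅ᶜ : Cl
∅ᶜ = mkCl (λ _ → false) (λ _ → 0 , λ _ _ → refl)

coordinate : ℕ → Cl
coordinate k = mkCl (λ x → x k) (λ x → suc k , λ y e → e k ℕₚ.≤-refl)

PointwiseContinuous : (2^ℕ → 2^ℕ) → Set
PointwiseContinuous f = ∀ x n → ∃[ m ] ∀ y → x ≈[ m ] y → f x ≈[ n ] f y

pullback : ∀ {f} → PointwiseContinuous f → Cl → Cl
pullback {f} c (mkCl g lc) = mkCl (g ∘ f) λ x →
  let (n , h) = lc (f x)
      (m , k) = c x n
  in m , λ y e → h (f y) (k y e)

pointwise⇒continuous : ∀ {f} → PointwiseContinuous f → Continuous f
pointwise⇒continuous {f} c U o {x} fx∈U =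
  let (n , N⊆U) = o fx∈U
      (m , k) = c x n
  in m , λ {y} e → N⊆U (k y e)

cylinder : 2^ℕ → ℕ → Cl
cylinder x zero    = ⊤ᶜ
-- The new condition is that coordinate `n` equals `x n`; `⊤ᶜ` is a dummy that turns `map₂ᶜ` into a
-- unary map.
cylinder x (suc n) = cylinder x n ∩ᶜ map₂ᶜ (λ b _ → if x n then b else not b) (coordinate n) ⊤ᶜ

∧-true : ∀ {a b} → a ∧ b ≡ true → a ≡ true × b ≡ true
∧-true {true} {true} _ = refl , refl

true-∧ : ∀ {a b} → a ≡ true → b ≡ true → a ∧ b ≡ true
true-∧ refl refl = refl

false≢true : ∀ {b} → b ≡ false → b ≢ true
false≢true refl ()

¬true⇒false : ∀ {b} → b ≢ true → b ≡ false
¬true⇒false {true}  h = ⊥-elim (h refl)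
¬true⇒false {false} _ = refl

private
  same-bit : ∀ b c → (if b then c else not c) ≡ true → b ≡ c
  same-bit true  true  _ = refl
  same-bit false false _ = refl

  bit-same : ∀ b → (if b then b else not b) ≡ true
  bit-same true  = refl
  bit-same false = refl

∈cylinder⇒≈[] : ∀ x n y → χ (cylinder x n) y ≡ true → x ≈[ n ] y
∈cylinder⇒≈[] x (suc n) y h i (ℕ.s≤s i≤n) with ℕₚ.m≤n⇒m<n∨m≡n i≤n
... | inj₁ i<n  = ∈cylinder⇒≈[] x n y (proj₁ (∧-true h)) i i<n
... | inj₂ refl = same-bit (x n) (y n) (proj₂ (∧-true {χ (cylinder x n) y} h))

x∈cylinder : ∀ x n → χ (cylinder x n) x ≡ true
x∈cylinder x zero    = refl
x∈cylinder x (suc n) = true-∧ (x∈cylinder x n) (bit-same (x n))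

⟦_⟧ : Cl → Clopen
⟦ a ⟧ = (λ x → χ a x ≡ true) ,
  (λ {x} e → let (n , h) = locallyConstant a x in n , λ {y} x≈y → trans (sym (h y x≈y)) e) ,
  (λ {x} ¬e → let (n , h) = locallyConstant a x in n , λ {y} x≈y e → ¬e (trans (h y x≈y) e))

-- evaluate n m is the Boolean function of the first n coordinates with code m.
evaluate : ℕ → ℕ → 2^ℕ → Bool
evaluate zero    zero    x = false
evaluate zero    (suc _) x = true
evaluate (suc n) m       x =
  evaluate n (if x 0 then proj₁ (unpair m) else proj₂ (unpair m)) (x ∘ suc)

evaluate-uniform : ∀ n m → UniformlyConstant (evaluate n m) n
evaluate-uniform zero    zero    x y _ = refl
evaluate-uniform zero    (suc m) x y _ = refl
evaluate-uniform (suc n) m       x y e rewrite e 0 (ℕ.s≤s ℕ.z≤n) =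
  evaluate-uniform n _ (x ∘ suc) (y ∘ suc) (λ i i<n → e (suc i) (ℕ.s≤s i<n))

evaluate-surjective : ∀ n f → UniformlyConstant f n → ∃[ m ] ∀ x → evaluate n m x ≡ f x
evaluate-surjective zero f uc with f (λ _ → false) in eq
... | false = 0 , λ x → trans (sym eq) (uc _ x λ _ ())
... | true  = 1 , λ x → trans (sym eq) (uc _ x λ _ ())
evaluate-surjective (suc n) f uc =
  let (mt , ht) = half true
      (mf , hf) = half false
      (m , e) = unpair-surjective mt mf
  in m , correct mt mf m e ht hf
  where
  half : ∀ b → ∃[ m ] ∀ x → evaluate n m x ≡ f (b ∷∞ x)
  half b = evaluate-surjective n (f ∘ (b ∷∞_)) λ x y e →
    uc _ _ λ { zero _ → refl ; (suc i) i<n → e i (ℕₚ.≤-pred i<n) }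
  correct : ∀ mt mf m → unpair m ≡ (mt , mf) →
    (∀ x → evaluate n mt x ≡ f (true ∷∞ x)) → (∀ x → evaluate n mf x ≡ f (false ∷∞ x)) →
    ∀ x → evaluate (suc n) m x ≡ f x
  correct mt mf m e ht hf x rewrite e with x 0 in eq
  ... | true  = trans (ht (x ∘ suc)) (uc _ _ λ { zero _ → sym eq ; (suc i) _ → refl })
  ... | false = trans (hf (x ∘ suc)) (uc _ _ λ { zero _ → sym eq ; (suc i) _ → refl })

-- The number `k` packs a depth and a truth table of that depth. Repetitions are harmless, since
-- only surjectivity up to `≗ᶜ` matters.
code : ℕ → Cl
code k = mkCl (evaluate n m) λ x → n , evaluate-uniform n m x
  where
  n = proj₁ (unpair k)
  m = proj₂ (unpair k)

module Classical (em : ∀ {ℓ} → ExcludedMiddle ℓ) where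

  byContradiction : ∀ {ℓ} {A : Set ℓ} → ¬ ¬ A → A
  byContradiction {A = A} ¬¬a with em {P = A}
  ... | yes a = a
  ... | no ¬a = ⊥-elim (¬¬a ¬a)

  compareℝ : ∀ x y → x ≺ y ⊎ x ≃ y ⊎ y ≺ x
  compareℝ x y with em {P = x ≺ y} | em {P = y ≺ x}
  ... | yes x≺y | _       = inj₁ x≺y
  ... | no _    | yes y≺x = inj₂ (inj₂ y≺x)
  ... | no x⊀y  | no y⊀x  = inj₂ (inj₁ (≮⇒≃ x⊀y y⊀x))

  -- Compactness of 2^ℕ: if f were not uniformly constant, then one could pass
  -- again and again to a half of the space on which f is not uniformly constant,
  -- and f would not be locally constant at the resulting branch.
  locallyConstant⇒uniformlyConstant : ∀ f → LocallyConstant f → ∃[ n ] UniformlyConstant f n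
  locallyConstant⇒uniformlyConstant f lc = byContradiction λ ¬uc →
    let s = (f , lc , ¬uc)
        (n , h) = lc (branch s)
    in noModulus n s h
    where
    State : Set
    State = Σ[ f ∈ (2^ℕ → Bool) ] LocallyConstant f × ¬ (∃[ n ] UniformlyConstant f n)
    badHalf : (s : State) → ∃[ b ] ¬ (∃[ n ] UniformlyConstant (proj₁ s ∘ (b ∷∞_)) n)
    badHalf (f , lc , ¬uc) = byContradiction λ none →
      ¬uc (uniform-children f lc λ b → byContradiction λ ¬ucb → none (b , ¬ucb))
    next : State → State
    next s@(f , lc , _) = let (b , ¬ucb) = badHalf s in f ∘ (b ∷∞_) , lc-∷∞ b lc , ¬ucb
    branch : State → 2^ℕ
    branch s zero    = proj₁ (badHalf s)
    branch s (suc i) = branch (next s) i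
    noModulus : ∀ n s → (∀ y → branch s ≈[ n ] y → proj₁ s (branch s) ≡ proj₁ s y) → ⊥
    noModulus zero s@(f , _ , ¬uc) h = ¬uc (0 , λ x y _ →
      trans (sym (h x λ _ ())) (h y λ _ ()))
    noModulus (suc n) s h = noModulus n (next s) λ y agree →
      trans (sym (h _ λ { zero _ → refl ; (suc i) _ → refl }))
        (h _ λ { zero _ → refl ; (suc i) i<n → agree i (ℕₚ.≤-pred i<n) })

  fromClopen : Clopen → Cl
  fromClopen (U , o , c) = mkCl (λ x → does (em {P = U x})) lc
    where
    lc : LocallyConstant (λ x → does (em {P = U x}))
    lc x with em {P = U x}
    ... | yes x∈U = let (n , N⊆U) = o x∈U in n , λ y e → inside y (N⊆U e)
      where
      inside : ∀ y → U y → true ≡ does (em {P = U y})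
      inside y y∈U with em {P = U y}
      ... | yes _ = refl
      ... | no y∉U = ⊥-elim (y∉U y∈U)
    ... | no x∉U = let (n , N⊆) = c x∉U in n , λ y e → outside y (N⊆ e)
      where
      outside : ∀ y → ¬ U y → false ≡ does (em {P = U y})
      outside y y∉U with em {P = U y}
      ... | yes y∈U = ⊥-elim (y∉U y∈U)
      ... | no _ = refl

  fromClopen-≐ : ∀ U → proj₁ U ≐ proj₁ ⟦ fromClopen U ⟧
  fromClopen-≐ (U , _) = (λ {x} → to x) , (λ {x} → from x)
    where
    to : ∀ x → U x → does (em {P = U x}) ≡ true
    to x x∈U with em {P = U x}
    ... | yes _  = refl
    ... | no x∉U = ⊥-elim (x∉U x∈U)
    from : ∀ x → does (em {P = U x}) ≡ true → U x
    from x e with em {P = U x}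
    ... | yes x∈U = x∈U
    from x () | no _

  code-surjective : ∀ a → ∃[ k ] code k ≗ᶜ a
  code-surjective a =
    let (n , uc) = locallyConstant⇒uniformlyConstant (χ a) (locallyConstant a)
        (m , h) = evaluate-surjective n (χ a) uc
        (k , e) = unpair-surjective n m
    in k , λ x → trans (cong (λ (n , m) → evaluate n m x) e) (h x)

  -- Measures

  x+x≃x⇒x≃0 : ∀ {x} → x + x ≃ x → x ≃ 0ℝ
  x+x≃x⇒x≃0 {x} e = +-cancelˡ x (≃-trans e (≃-sym (+-identityʳ x)))

  0≺x⇒0≺x+y : ∀ {x y} → 0ℝ ≺ x → ¬ (y ≺ 0ℝ) → 0ℝ ≺ x + y
  0≺x⇒0≺x+y {x} {y} 0≺x y⊀0 with compareℝ 0ℝ y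
  ... | inj₁ 0≺y        = ≺-trans 0≺x (≺-respˡ (+-identityʳ x) (+-monoʳ-≺ x 0≺y))
  ... | inj₂ (inj₁ 0≃y) = ≺-respʳ (≃-trans (≃-sym (+-identityʳ x)) (+-cong ≃-refl 0≃y)) 0≺x
  ... | inj₂ (inj₂ y≺0) = ⊥-elim (y⊀0 y≺0)

  -- Padding with empty sets makes finite additivity an instance of countable additivity.
  onTwo : Pred 2^ℕ 0ℓ → Pred 2^ℕ 0ℓ → ℕ → Pred 2^ℕ 0ℓ
  onTwo A B zero          = A
  onTwo A B (suc zero)    = B
  onTwo A B (suc (suc _)) = λ _ → ⊥

  onTwo-disjoint : ∀ {A B} → A ⟂ B → ∀ m n → m ≢ n → onTwo A B m ⟂ onTwo A B n
  onTwo-disjoint d zero          zero          m≢n _       = m≢n refl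
  onTwo-disjoint d zero          (suc zero)    m≢n (a , b) = d (a , b)
  onTwo-disjoint d (suc zero)    zero          m≢n (b , a) = d (a , b)
  onTwo-disjoint d (suc zero)    (suc zero)    m≢n _       = m≢n refl
  onTwo-disjoint d (suc (suc m)) n             m≢n (() , _)
  onTwo-disjoint d zero          (suc (suc n)) m≢n (_ , ())
  onTwo-disjoint d (suc zero)    (suc (suc n)) m≢n (_ , ())

  ⋃-onTwo : ∀ {A B} → ⋃ ℕ (onTwo A B) ≐ A ∪ B
  ⋃-onTwo = (λ { (zero , a) → inj₁ a ; (suc zero , b) → inj₂ b })
          , (λ { (inj₁ a) → zero , a ; (inj₂ b) → suc zero , b })

  borel-∅ : Borel (λ _ → ⊥)
  borel-∅ = isOpen λ ()

  onTwo-borel : ∀ {A B} → Borel A → Borel B → ∀ n → Borel (onTwo A B n)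
  onTwo-borel a b zero          = a
  onTwo-borel a b (suc zero)    = b
  onTwo-borel a b (suc (suc _)) = borel-∅

  borel-∪ : ∀ {A B} → Borel A → Borel B → Borel (A ∪ B)
  borel-∪ a b = resp ⋃-onTwo (union (onTwo-borel a b))

  module _ (μ : ProbabilityMeasure) where

    measure-cong : ∀ {A B} (a : Borel A) (b : Borel B) → A ≐ B → measure μ a ≃ measure μ b
    measure-cong a b e = ≈⇒≃ (measure-≐ μ a b e)

    -- Countably many copies of an empty set are disjoint, and their partial sums tend to the mass
    -- `u` of the union. Adding one more copy only shifts the sequence of sums, so `u + measure μ a`
    -- equals `u`.
    measure-∅ : ∀ {A} (a : Borel A) → (∀ x → ¬ A x) → measure μ a ≃ 0ℝ
    measure-∅ {A} a ∅ = +-cancelˡ u (≃-trans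
      (lim-unique (λ n → S n + measure μ a) (λ n → S (suc n)) (λ _ → ≃-refl)
        (lim-+ S {u} (measure μ a) S⟶u) (lim-shift S {u} S⟶u)) (≃-sym (+-identityʳ u)))
      where
      u = measure μ (union (λ _ → a))
      S = partialSum (λ _ → measure μ a)
      S⟶u : S ⟶ u
      S⟶u = additive μ (λ _ → a) λ _ _ _ {x} (x∈A , _) → ∅ x x∈A

    measure-∪ : ∀ {A B C} (a : Borel A) (b : Borel B) (c : Borel C) → A ⟂ B → C ≐ A ∪ B →
      measure μ c ≃ measure μ a + measure μ b
    measure-∪ {A} {B} a b c d C≐A∪B = ≃-trans
      (measure-cong c (union f) ((λ {x} x∈C → proj₂ ⋃-onTwo (proj₁ C≐A∪B x∈C)) ,
                                 (λ {x} x∈⋃ → proj₂ C≐A∪B (proj₁ ⋃-onTwo x∈⋃))))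
      (lim-unique S S {measure μ (union f)} {measure μ a + measure μ b} (λ _ → ≃-refl) (additive μ f (onTwo-disjoint d))
        (eventually-constant {S} 2 sums))
      where
      f = onTwo-borel a b
      S = partialSum (λ n → measure μ (f n))
      sums : ∀ n → 2 ℕ.≤ n → S n ≃ measure μ a + measure μ b
      sums (suc zero) (ℕ.s≤s ())
      sums (suc (suc zero)) _ = +-cong (+-identityˡ _) ≃-refl
      sums (suc (suc (suc n))) _ = ≃-trans
        (+-cong (sums (suc (suc n)) (ℕ.s≤s (ℕ.s≤s ℕ.z≤n))) (measure-∅ (f (suc (suc n))) λ _ ()))
        (+-identityʳ _)

    measure-positive : ∀ {A B} (a : Borel A) (b : Borel B) → A ⊆ B →
      0ℝ ≺ measure μ a → 0ℝ ≺ measure μ b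
    measure-positive {A} {B} a b A⊆B 0≺a = ≺-respʳ (≃-sym (measure-∪ a rest b
        (λ (x∈A , x∈rest) → x∈rest (inj₂ x∈A)) (split , unsplit)))
      (0≺x⇒0≺x+y 0≺a λ m≺0 → nonneg μ rest (≺⇒< m≺0))
      where
      -- This is the difference of `B` and `A`, written with the operations that `Borel` offers.
      rest : Borel (∁ (∁ B ∪ A))
      rest = complement (borel-∪ (complement b) a)
      split : B ⊆ A ∪ ∁ (∁ B ∪ A)
      split {x} x∈B with em {P = A x}
      ... | yes x∈A = inj₁ x∈A
      ... | no x∉A = inj₂ λ { (inj₁ x∉B) → x∉B x∈B ; (inj₂ x∈A) → x∉A x∈A }
      unsplit : A ∪ ∁ (∁ B ∪ A) ⊆ B
      unsplit (inj₁ x∈A) = A⊆B x∈A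
      unsplit (inj₂ h) = byContradiction λ x∉B → h (inj₁ x∉B)

  -- Two measures that agree on clopen sets visibly agree on these sets; by
  -- Dynkin's π-λ theorem (borel⇒dynkin) they are all the Borel sets.
  data Dynkin : Pred 2^ℕ 0ℓ → Set₁ where
    clopen     : ∀ a → Dynkin (proj₁ ⟦ a ⟧)
    complement : ∀ {B} → Dynkin B → Dynkin (∁ B)
    union      : ∀ {B : ℕ → Pred 2^ℕ 0ℓ} → (∀ n → Dynkin (B n)) →
                 (∀ m n → m ≢ n → B m ⟂ B n) → Dynkin (⋃ ℕ B)
    resp       : ∀ {B C} → B ≐ C → Dynkin B → Dynkin C

  private
    dynkin-∅ : Dynkin (λ _ → ⊥)
    dynkin-∅ = resp ((λ ()) , (λ ())) (clopen ∅ᶜ)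

    dynkin-∪ : ∀ {A B} → Dynkin A → Dynkin B → A ⟂ B → Dynkin (A ∪ B)
    dynkin-∪ {A} {B} a b d = resp ⋃-onTwo (union f (onTwo-disjoint d))
      where
      f : ∀ n → Dynkin (onTwo A B n)
      f zero          = a
      f (suc zero)    = b
      f (suc (suc _)) = dynkin-∅

    -- For fixed `A`, the sets whose intersection with `A` is in the class are closed under the
    -- Dynkin operations. For complements, `A` without `B` is the complement of the disjoint union
    -- of `∁ A` and `A ∩ B`.
    dynkin-∩-step : ∀ {A} → Dynkin A → (∀ c → Dynkin (A ∩ proj₁ ⟦ c ⟧)) →
      ∀ {B} → Dynkin B → Dynkin (A ∩ B)
    dynkin-∩-step a h (clopen c) = h c
    dynkin-∩-step {A} a h (complement {B} b) =
      resp ((λ {x} k → byContradiction (λ x∉A → k (inj₁ x∉A)) ,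
                       λ x∈B → k (inj₂ (byContradiction (λ x∉A → k (inj₁ x∉A)) , x∈B))) ,
            (λ { (x∈A , _) (inj₁ x∉A) → x∉A x∈A ; (_ , x∉B) (inj₂ (_ , x∈B)) → x∉B x∈B }))
        (complement (dynkin-∪ (complement a) (dynkin-∩-step a h b) λ (x∉A , x∈A , _) → x∉A x∈A))
    dynkin-∩-step a h (union b d) =
      resp ((λ (n , x∈A , x∈B) → x∈A , n , x∈B) , (λ (x∈A , n , x∈B) → n , x∈A , x∈B))
        (union (λ n → dynkin-∩-step a h (b n)) λ m n m≢n ((_ , p) , (_ , q)) → d m n m≢n (p , q))
    dynkin-∩-step a h (resp (f , g) b) =
      resp ((λ (p , q) → p , f q) , (λ (p , q) → p , g q)) (dynkin-∩-step a h b)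

    -- The step is used twice: clopen sets meet clopen sets in clopen sets, which extends to a
    -- clopen set and any `A`, and then to `A` and any `B`.
    dynkin-∩ : ∀ {A B} → Dynkin A → Dynkin B → Dynkin (A ∩ B)
    dynkin-∩ {A} a b = dynkin-∩-step a withClopen b
      where
      withClopen : ∀ c → Dynkin (A ∩ proj₁ ⟦ c ⟧)
      withClopen c = resp ((λ (p , q) → q , p) , (λ (p , q) → q , p))
        (dynkin-∩-step (clopen c) (λ d → resp
          ((λ e → ∧-true e) , (λ (p , q) → true-∧ p q))
          (clopen (c ∩ᶜ d))) a)

    before : (ℕ → Pred 2^ℕ 0ℓ) → ℕ → Pred 2^ℕ 0ℓ
    before B zero    = ∁ (λ _ → ⊥)
    before B (suc n) = before B n ∩ ∁ (B n)

    before-∉ : ∀ (B : ℕ → Pred 2^ℕ 0ℓ) {m n x} → m ℕ.< n → before B n x → ¬ B m x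
    before-∉ B {m} {suc n} m<1+n (p , q) x∈B with ℕₚ.m≤n⇒m<n∨m≡n (ℕₚ.≤-pred m<1+n)
    ... | inj₁ m<n  = before-∉ B m<n p x∈B
    ... | inj₂ refl = q x∈B

    first : ∀ (B : ℕ → Pred 2^ℕ 0ℓ) n {x} → B n x → ∃[ m ] (before B m x × B m x)
    first B n {x} x∈B = search (reach n)
      where
      search : before B n x ⊎ ∃[ m ] (before B m x × B m x) → ∃[ m ] (before B m x × B m x)
      search (inj₁ h) = n , h , x∈B
      search (inj₂ h) = h
      reach : ∀ k → before B k x ⊎ ∃[ m ] (before B m x × B m x)
      reach zero = inj₁ λ ()
      reach (suc k) with reach k | em {P = B k x}
      ... | inj₂ h | _ = inj₂ h
      ... | inj₁ h | yes p = inj₂ (k , h , p)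
      ... | inj₁ h | no p = inj₁ (h , p)

    -- Removing from each set the earlier ones makes the union disjoint; this is what closure under
    -- intersections is for.
    dynkin-⋃ : ∀ {B : ℕ → Pred 2^ℕ 0ℓ} → (∀ n → Dynkin (B n)) → Dynkin (⋃ ℕ B)
    dynkin-⋃ {B} b = resp ((λ (n , _ , p) → n , p) , (λ (n , p) → first B n p))
      (union (λ n → dynkin-∩ (d n) (b n)) disjoint)
      where
      d : ∀ n → Dynkin (before B n)
      d zero    = complement dynkin-∅
      d (suc n) = dynkin-∩ (d n) (complement (b n))
      disjoint : ∀ m n → m ≢ n → (before B m ∩ B m) ⟂ (before B n ∩ B n)
      disjoint m n m≢n ((p , x∈m) , (q , x∈n)) with ℕₚ.<-cmp m n
      ... | tri< m<n _ _ = before-∉ B m<n q x∈m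
      ... | tri≈ _ m≡n _ = m≢n m≡n
      ... | tri> _ _ n<m = before-∉ B n<m p x∈n

  inOpen : ∀ {O} → IsOpen O → ∀ {x} → O x → ∃[ a ] (χ a x ≡ true × proj₁ ⟦ a ⟧ ⊆ O)
  inOpen o {x} x∈O = let (n , N⊆O) = o x∈O in
    cylinder x n , x∈cylinder x n , λ {y} h → N⊆O (∈cylinder⇒≈[] x n y h)

  borel⇒dynkin : ∀ {B} → Borel B → Dynkin B
  borel⇒dynkin (isOpen {O} o) = resp ((λ (_ , x∈a , a⊆O) → a⊆O x∈a) , cover) (dynkin-⋃ cell)
    where
    -- The coded clopen sets inside `O` cover it. A code that sticks out contributes the empty set,
    -- so the family is indexed by all of ℕ.
    Cell : ℕ → Pred 2^ℕ 0ℓ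
    Cell k x = χ (code k) x ≡ true × proj₁ ⟦ code k ⟧ ⊆ O
    cell : ∀ k → Dynkin (Cell k)
    cell k with em {P = proj₁ ⟦ code k ⟧ ⊆ O}
    ... | yes p = resp ((λ e → e , λ {y} → p {y}) , proj₁) (clopen (code k))
    ... | no p  = resp ((λ ()) , (λ (_ , q) → p (λ {y} → q {y}))) dynkin-∅
    cover : O ⊆ ⋃ ℕ Cell
    cover x∈O =
      let (a , x∈a , a⊆O) = inOpen o x∈O
          (k , e) = code-surjective a
      in k , trans (e _) x∈a , λ {y} y∈ → a⊆O (trans (sym (e y)) y∈)
  borel⇒dynkin (complement b) = complement (borel⇒dynkin b)
  borel⇒dynkin (union b) = dynkin-⋃ (λ n → borel⇒dynkin (b n))
  borel⇒dynkin (resp e b) = resp e (borel⇒dynkin b)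

  private
    -- `measure` takes a `Borel` derivation, so an induction over `Dynkin` needs one for each set
    -- that it visits.
    dynkin⇒borel : ∀ {B} → Dynkin B → Borel B
    dynkin⇒borel (clopen a)     = isOpen (proj₁ (proj₂ ⟦ a ⟧))
    dynkin⇒borel (complement b) = complement (dynkin⇒borel b)
    dynkin⇒borel (union b _)    = union (λ n → dynkin⇒borel (b n))
    dynkin⇒borel (resp e b)     = resp e (dynkin⇒borel b)

  mass : ProbabilityMeasure → Cl → ℝ
  mass μ a = μ ⟨ ⟦ a ⟧ ⟩

  module _ {μ ν : ProbabilityMeasure} (same : ∀ a → mass μ a ≃ mass ν a) where

    private
      measure-∁ : ∀ (ρ : ProbabilityMeasure) {B} (b : Borel B) →
        measure ρ b + measure ρ (complement b) ≃ 1ℝ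
      measure-∁ ρ {B} b = ≃-trans
        (≃-sym (measure-∪ ρ b (complement b) whole (λ (p , q) → q p) (cover , λ _ → refl)))
        (≈⇒≃ (total ρ whole (λ _ → refl)))
        where
        whole = isOpen (proj₁ (proj₂ ⟦ ⊤ᶜ ⟧))
        cover : proj₁ ⟦ ⊤ᶜ ⟧ ⊆ B ∪ ∁ B
        cover {x} _ with em {P = B x}
        ... | yes p = inj₁ p
        ... | no p  = inj₂ p

      dynkin-same : ∀ {B} (b : Dynkin B) → measure μ (dynkin⇒borel b) ≃ measure ν (dynkin⇒borel b)
      dynkin-same (clopen a)     = same a
      dynkin-same (complement b) = +-cancelˡ (measure μ (dynkin⇒borel b)) (≃-trans
        (≃-trans (measure-∁ μ (dynkin⇒borel b)) (≃-sym (measure-∁ ν (dynkin⇒borel b))))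
        (+-cong (≃-sym (dynkin-same b)) ≃-refl))
      dynkin-same (union b d)    = lim-unique
        (partialSum λ n → measure μ (dynkin⇒borel (b n))) (partialSum λ n → measure ν (dynkin⇒borel (b n)))
        (sums (λ n → dynkin-same (b n)))
        (additive μ (λ n → dynkin⇒borel (b n)) d) (additive ν (λ n → dynkin⇒borel (b n)) d)
        where
        sums : ∀ {x y : ℕ → ℝ} → (∀ n → x n ≃ y n) → ∀ n → partialSum x n ≃ partialSum y n
        sums e zero    = ≃-refl
        sums e (suc n) = +-cong (sums e n) (e n)
      dynkin-same (resp e b)     = ≃-trans
        (measure-cong μ (dynkin⇒borel (resp e b)) (dynkin⇒borel b) (proj₂ e , proj₁ e))
        (≃-trans (dynkin-same b) (measure-cong ν (dynkin⇒borel b) (dynkin⇒borel (resp e b)) e))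

    mass-determines : ∀ {B} (b : Borel B) → measure μ b ≃ measure ν b
    mass-determines b = ≃-trans (measure-cong μ b b′ (id , id))
      (≃-trans (dynkin-same (borel⇒dynkin b)) (measure-cong ν b′ b (id , id)))
      where b′ = dynkin⇒borel (borel⇒dynkin b)

  -- Contents on the algebra of clopen sets

  -- Splitting `a` by `b` expresses finite additivity without a disjointness hypothesis.
  -- Nonnegativity is kept apart; for limits of measures it comes from `Positive`.
  record IsContent (m : Cl → ℝ) : Set where
    field
      content-cong  : ∀ {a b} → a ≗ᶜ b → m a ≃ m b
      content-split : ∀ a b → m a ≃ m (a ∩ᶜ b) + m (a ∖ᶜ b)
      content-total : m ⊤ᶜ ≃ 1ℝ

    content-∅ : m ∅ᶜ ≃ 0ℝ
    content-∅ = x+x≃x⇒x≃0 (≃-sym (≃-trans (content-split ∅ᶜ ∅ᶜ)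
      (+-cong (content-cong λ _ → refl) (content-cong λ _ → refl))))

    content-empty : ∀ {a} → ¬ Nonempty a → m a ≃ 0ℝ
    content-empty ¬a = ≃-trans (content-cong λ x → ¬true⇒false λ e → ¬a (x , e)) content-∅

    content-positive⇒nonempty : ∀ {a} → 0ℝ ≺ m a → Nonempty a
    content-positive⇒nonempty {a} 0≺a = byContradiction λ ¬a →
      ≺-irrefl (≃-sym (content-empty {a} ¬a)) 0≺a

    content-⊑ : ∀ {a b} → a ⊑ b → m b ≃ m a + m (b ∖ᶜ a)
    content-⊑ {a} {b} a⊑b = ≃-trans (content-split b a) (+-cong (content-cong meet) ≃-refl)
      where
      meet : b ∩ᶜ a ≗ᶜ a
      meet x with χ a x in e
      ... | false = 𝔹ₚ.∧-zeroʳ (χ b x)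
      ... | true  = trans (cong (_∧ true) (a⊑b x e)) refl

    content-positive-difference : ∀ {a b} → a ⊑ b → 0ℝ ≺ m (b ∖ᶜ a) → m a ≺ m b
    content-positive-difference {a} {b} a⊑b 0≺ = ≺-respʳ (≃-sym (content-⊑ {a} {b} a⊑b))
      (≺-respˡ (+-identityʳ (m a)) (+-monoʳ-≺ (m a) 0≺))

  open IsContent public

  Positive : (Cl → ℝ) → Set
  Positive m = ∀ a → Nonempty a → 0ℝ ≺ m a

  module _ (μ : ProbabilityMeasure) where

    private
      borel : ∀ a → Borel (proj₁ ⟦ a ⟧)
      borel a = isOpen (proj₁ (proj₂ ⟦ a ⟧))

    mass-content : IsContent (mass μ)
    mass-content = record
      { content-cong = λ {a} {b} e → measure-cong μ (borel a) (borel b)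
          ((λ {x} p → trans (sym (e x)) p) , (λ {x} p → trans (e x) p))
      ; content-split = λ a b → measure-∪ μ (borel (a ∩ᶜ b)) (borel (a ∖ᶜ b)) (borel a)
          (λ {x} (p , q) → disjoint (χ a x) (χ b x) p q)
          ((λ {x} → cover (χ a x) (χ b x)) , (λ {x} → λ { (inj₁ p) → proj₁ (∧-true p) ; (inj₂ p) → proj₁ (∧-true p) }))
      ; content-total = ≈⇒≃ (total μ (borel ⊤ᶜ) (λ _ → refl))
      }
      where
      disjoint : ∀ a b → a ∧ b ≡ true → a ∧ not b ≢ true
      disjoint true true _ ()
      cover : ∀ a b → a ≡ true → a ∧ b ≡ true ⊎ a ∧ not b ≡ true
      cover true true  _ = inj₁ refl
      cover true false _ = inj₂ refl

    value-mass : ∀ U → μ ⟨ U ⟩ ≃ mass μ (fromClopen U)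
    value-mass U@(_ , o , _) = measure-cong μ (isOpen o) (borel (fromClopen U)) (fromClopen-≐ U)

    full⇒positive : IsFull μ → Positive (mass μ)
    full⇒positive full a (x , e) = <⇒≺ (full (proj₁ (proj₂ ⟦ a ⟧)) (x , e))

    positive⇒full : Positive (mass μ) → IsFull μ
    positive⇒full pos o (x , x∈O) = let (a , x∈a , a⊆O) = inOpen o x∈O in
      ≺⇒< (measure-positive μ (borel a) (isOpen o) (λ {y} → a⊆O {y}) (pos a (x , x∈a)))

    pushforward : ∀ {f} → Continuous f → ProbabilityMeasure
    pushforward c = record
      { measure   = λ b → measure μ (preimage c b)
      ; measure-≐ = λ b c′ (⊆C , C⊆) → measure-≐ μ (preimage c b) (preimage c c′) (⊆C , C⊆)
      ; nonneg    = λ b → nonneg μ (preimage c b)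
      ; total     = λ b u → total μ (preimage c b) (λ x → u _)
      ; additive  = λ b disjoint →
          additive μ (λ n → preimage c (b n)) (λ m n m≢n → disjoint m n m≢n)
      }

    mass-pushforward : ∀ {f} (c : PointwiseContinuous f) a →
      mass (pushforward (pointwise⇒continuous c)) a ≃ mass μ (pullback c a)
    mass-pushforward {f} c a = measure-cong μ
      (preimage {f} (pointwise⇒continuous c) (borel a)) (borel (pullback c a)) (id , id)

  -- Schemes of clopen sets

  -- A node t is the reversed list of the choices made from the root: the head of
  -- t is the most recent choice.
  record Scheme : Set where
    field
      cell       : List Bool → Cl
      cell-root  : ∀ x → χ (cell []) x ≡ true
      cell-true  : ∀ t → cell (true ∷ t) ⊑ cell t
      cell-false : ∀ t → cell (false ∷ t) ≗ᶜ cell t ∖ᶜ cell (true ∷ t)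

    infix 4 _∈ᶜ_
    _∈ᶜ_ : 2^ℕ → List Bool → Set
    x ∈ᶜ t = χ (cell t) x ≡ true

    address : 2^ℕ → ℕ → List Bool
    address x zero    = []
    address x (suc n) = χ (cell (true ∷ address x n)) x ∷ address x n

    length-address : ∀ x n → length (address x n) ≡ n
    length-address x zero    = refl
    length-address x (suc n) = cong suc (length-address x n)

    ∈address : ∀ x n → x ∈ᶜ address x n
    ∈address x zero = cell-root x
    ∈address x (suc n) with χ (cell (true ∷ address x n)) x in e
    ... | true  = e
    ... | false = trans (cell-false (address x n) x)
      (cong₂ (λ b c → b ∧ not c) (∈address x n) e)

    child⊑ : ∀ b t → cell (b ∷ t) ⊑ cell t
    child⊑ true  t x h = cell-true t x h
    child⊑ false t x h = proj₁ (∧-true (trans (sym (cell-false t x)) h))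

    address-unique : ∀ {x} t → x ∈ᶜ t → t ≡ address x (length t)
    address-unique [] _ = refl
    address-unique {x} (b ∷ t) h = cong₂ _∷_ (choice b h) rest
      where
      rest : t ≡ address x (length t)
      rest = address-unique t (child⊑ b t x h)
      choice : ∀ b → x ∈ᶜ (b ∷ t) → b ≡ χ (cell (true ∷ address x (length t))) x
      choice true h = trans (sym h) (cong (λ t → χ (cell (true ∷ t)) x) rest)
      choice false h = trans
        (sym (¬true⇒false λ e → not-both (proj₂ (∧-true {χ (cell t) x} (trans (sym (cell-false t x)) h))) e))
        (cong (λ t → χ (cell (true ∷ t)) x) rest)
        where
        not-both : ∀ {b} → not b ≡ true → b ≢ true
        not-both {false} _ ()

    ∈address⇒≡ : ∀ {x y} n → y ∈ᶜ address x n → address y n ≡ address x n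
    ∈address⇒≡ {x} {y} n h = trans (cong (address y) (sym (length-address x n)))
      (sym (address-unique (address x n) h))

    address-continuous : ∀ x n → ∃[ m ] ∀ y → x ≈[ m ] y → address y n ≡ address x n
    address-continuous x n =
      let (m , h) = locallyConstant (cell (address x n)) x
      in m , λ y e → ∈address⇒≡ n (trans (sym (h y e)) (∈address x n))

    -- The depth `d` depends on `n` alone. By this uniformity a single level of the tree resolves a
    -- whole clopen set.
    Separating : Set
    Separating = ∀ n → ∃[ d ] ∀ x y → address x d ≡ address y d → x ≈[ n ] y

    separating-≗ : Separating → ∀ {x y} → (∀ n → address x n ≡ address y n) → ∀ i → x i ≡ y i
    separating-≗ sep {x} {y} e i = let (d , h) = sep (suc i) in h x y (e d) i ℕₚ.≤-refl

    module _ {m : Cl → ℝ} (content : IsContent m) where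

      content-children : ∀ t c →
        m (cell t ∩ᶜ c) ≃ m (cell (true ∷ t) ∩ᶜ c) + m (cell (false ∷ t) ∩ᶜ c)
      content-children t c = ≃-trans (content-split content (cell t ∩ᶜ c) (cell (true ∷ t)))
        (+-cong
          (content-cong content λ x → onTrue (χ (cell t) x) _ (χ c x) (cell-true t x))
          (content-cong content λ x → trans (onFalse (χ (cell t) x) _ (χ c x))
            (cong (_∧ χ c x) (sym (cell-false t x)))))
        where
        onTrue : ∀ a b c → (b ≡ true → a ≡ true) → (a ∧ c) ∧ b ≡ b ∧ c
        onTrue a true c h rewrite h refl = 𝔹ₚ.∧-identityʳ c
        onTrue a false c h = 𝔹ₚ.∧-zeroʳ (a ∧ c)
        onFalse : ∀ a b c → (a ∧ c) ∧ not b ≡ (a ∧ not b) ∧ c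
        onFalse false b c = refl
        onFalse true b c = 𝔹ₚ.∧-comm c (not b)

  open Scheme

  address-truncate : ∀ A B {x y m n} → m ℕ.≤ n →
    address A x n ≡ address B y n → address A x m ≡ address B y m
  address-truncate A B {n = zero}  ℕ.z≤n _ = refl
  address-truncate A B {n = suc n} m≤n e with ℕₚ.m≤n⇒m<n∨m≡n m≤n
  ... | inj₁ m<1+n = address-truncate A B (ℕₚ.≤-pred m<1+n) (∷-injectiveʳ e)
  ... | inj₂ refl  = e

  cylinders : Scheme
  cylinders = record
    { cell = cyl
    ; cell-root = λ _ → refl
    ; cell-true = λ t x h → proj₁ (∧-true h)
    ; cell-false = λ t x → absorb (χ (cyl t) x) (x (length t)) }
    where
    cyl : List Bool → Cl
    cyl []          = ⊤ᶜ
    -- Nodes are reversed lists, so the head added to `t` is the value of coordinate `length t`.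
    cyl (true ∷ t)  = cyl t ∩ᶜ coordinate (length t)
    cyl (false ∷ t) = cyl t ∖ᶜ coordinate (length t)
    absorb : ∀ a b → a ∧ not b ≡ a ∧ not (a ∧ b)
    absorb true  b = refl
    absorb false b = refl

  cylinders-head : ∀ x n → χ (cell cylinders (true ∷ address cylinders x n)) x ≡ x n
  cylinders-head x n = cong₂ _∧_ (∈address cylinders x n) (cong x (length-address cylinders x n))

  cylinders-agree : ∀ {x y} n → address cylinders x n ≡ address cylinders y n → x ≈[ n ] y
  cylinders-agree {x} {y} (suc n) e i (ℕ.s≤s i≤n) with ℕₚ.m≤n⇒m<n∨m≡n i≤n
  ... | inj₁ i<n  = cylinders-agree n (∷-injectiveʳ e) i i<n
  ... | inj₂ refl = trans (sym (cylinders-head x n)) (trans (proj₁ (∷-injective e)) (cylinders-head y n))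

  cylinders-nonempty : ∀ t → Nonempty (cell cylinders t)
  cylinders-nonempty t = point t , subst (_∈ᶜ_ cylinders (point t)) (own t) (∈address cylinders (point t) (length t))
    where
    at : List Bool → 2^ℕ
    -- Coordinates beyond the node are arbitrary; the default is `false`.
    at []      i = false
    at (b ∷ t) i with i ℕₚ.≟ length t
    ... | yes _ = b
    ... | no _  = at t i
    point = at
    at-head : ∀ b t → at (b ∷ t) (length t) ≡ b
    at-head b t with length t ℕₚ.≟ length t
    ... | yes _ = refl
    ... | no h  = ⊥-elim (h refl)
    at-tail : ∀ b t i → i ℕ.< length t → at (b ∷ t) i ≡ at t i
    at-tail b t i i<n with i ℕₚ.≟ length t
    ... | yes refl = ⊥-elim (ℕₚ.<-irrefl refl i<n)
    ... | no _     = refl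
    agree : ∀ {x y} n → x ≈[ n ] y → address cylinders x n ≡ address cylinders y n
    agree zero    _ = refl
    agree {x} {y} (suc n) h = cong₂ _∷_
      (trans (cylinders-head x n) (trans (h n ℕₚ.≤-refl) (sym (cylinders-head y n))))
      (agree n (≈[]-weaken (ℕₚ.n≤1+n n) h))
    own : ∀ t → address cylinders (point t) (length t) ≡ t
    own []      = refl
    own (b ∷ t) = cong₂ _∷_ (trans (cylinders-head (at (b ∷ t)) (length t)) (at-head b t))
      (trans (agree (length t) (at-tail b t)) (own t))

  -- Matching the branches of two schemes

  maximum : (ℕ → ℕ) → ℕ → ℕ
  maximum f zero    = 0
  maximum f (suc n) = f n ℕ.⊔ maximum f n

  ≤maximum : ∀ f {i n} → i ℕ.< n → f i ℕ.≤ maximum f n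
  ≤maximum f {i} {suc n} (ℕ.s≤s i≤n) with ℕₚ.m≤n⇒m<n∨m≡n i≤n
  ... | inj₁ i<n  = ℕₚ.≤-trans (≤maximum f i<n) (ℕₚ.m≤n⊔m (f n) _)
  ... | inj₂ refl = ℕₚ.m≤m⊔n (f n) _

  -- The image of `x` is to be the only point common to the cells of `B` along the address of `x` in
  -- `A`. Each coordinate is determined at a finite depth, so it can be read off a sample point of
  -- the cell at that depth.
  module Match (A B : Scheme) (sep : Separating B)
    (nonempty : ∀ t → Nonempty (cell A t) → Nonempty (cell B t)) where

    private
      sample : 2^ℕ → ℕ → 2^ℕ
      sample x n = proj₁ (nonempty (address A x n) (x , ∈address A x n))

      address-sample : ∀ x n → address B (sample x n) n ≡ address A x n
      address-sample x n = trans
        (cong (address B (sample x n)) (sym (length-address A x n)))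
        (sym (address-unique B (address A x n) (proj₂ (nonempty (address A x n) (x , ∈address A x n)))))

      truncate : ∀ x {m n} → m ℕ.≤ n → address B (sample x n) m ≡ address A x m
      truncate x {m} {n} m≤n = address-truncate B A m≤n (address-sample x n)

      depth : ℕ → ℕ
      depth i = proj₁ (sep (suc i))

    abstract
      match : 2^ℕ → 2^ℕ
      match x i = sample x (depth i) i

      match-coordinate : ∀ x i → match x i ≡ sample x (depth i) i
      match-coordinate x i = refl

    -- Whether a point lies in the cell of `y` at level `n` is decided near `y` by `N` coordinates.
    -- The sample `z` at depth `D` agrees with `y` on these, so it shares the address of `y` in `B`;
    -- by its choice it also has the address of `x` in `A`.
    match-address : ∀ x n → address B (match x) n ≡ address A x n
    match-address x n = trans (sym (∈address⇒≡ B n (trans (sym (h z near)) (∈address B y n)))) (truncate x n≤D)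
      where
      y = match x
      N = proj₁ (locallyConstant (cell B (address B y n)) y)
      h = proj₂ (locallyConstant (cell B (address B y n)) y)
      D = n ℕ.⊔ maximum depth N
      n≤D = ℕₚ.m≤m⊔n n (maximum depth N)
      z = sample x D
      near : y ≈[ N ] z
      near i i<N = trans (match-coordinate x i) (proj₂ (sep (suc i)) (sample x (depth i)) z
        (trans (address-sample x (depth i))
          (sym (truncate x (ℕₚ.≤-trans (≤maximum depth i<N) (ℕₚ.m≤n⊔m n _))))) i ℕₚ.≤-refl)

    abstract
      match-continuous : PointwiseContinuous match
      match-continuous x n =
        let (d , h) = sep n
            (m , k) = address-continuous A x d
        in m , λ y e → h (match x) (match y)
             (trans (match-address x d) (trans (sym (k y e)) (sym (match-address y d))))

    -- At depth `d` every cell of `B` lies inside `c` or misses it, and the cell of `A` at the same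
    -- node behaves alike towards the pullback. So equal masses at that depth suffice, and
    -- additivity sums them up to the root.
    match-content-at : ∀ {m₁ m₂} → IsContent m₁ → IsContent m₂ → ∀ c d →
      (∀ t {y z} → length t ≡ d → _∈ᶜ_ B y t → _∈ᶜ_ B z t → χ c y ≡ χ c z) →
      (∀ t → length t ≡ d → m₁ (cell A t) ≃ m₂ (cell B t)) →
      m₁ (pullback match-continuous c) ≃ m₂ c
    match-content-at {m₁} {m₂} ct₁ ct₂ c d constant same =
      ≃-trans (≃-sym (whole ct₁ A c′)) (≃-trans (below d [] refl) (whole ct₂ B c))
      where
      c′ = pullback match-continuous c
      whole : ∀ {m} → IsContent m → ∀ S c → m (cell S [] ∩ᶜ c) ≃ m c
      whole ct S c = content-cong ct λ x → cong (_∧ χ c x) (cell-root S x)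
      into : ∀ x t → _∈ᶜ_ A x t → _∈ᶜ_ B (match x) t
      into x t x∈t = subst (_∈ᶜ_ B (match x))
        (trans (match-address x (length t)) (sym (address-unique A t x∈t)))
        (∈address B (match x) (length t))
      meet : ∀ {a b} → (a ≡ true → b ≡ true) → a ∧ b ≡ a
      meet {true}  h = h refl
      meet {false} h = refl
      leaf : ∀ t → length t ≡ d → m₁ (cell A t ∩ᶜ c′) ≃ m₂ (cell B t ∩ᶜ c)
      leaf t e with em {P = Nonempty (cell B t ∩ᶜ c)}
      ... | yes (y , y∈) =
        let (y∈t , y∈c) = ∧-true y∈
        in ≃-trans (content-cong ct₁ λ x → meet λ x∈t → trans (sym (constant t e y∈t (into x t x∈t))) y∈c)
          (≃-trans (same t e)
            (≃-sym (content-cong ct₂ λ z → meet λ z∈t → trans (sym (constant t e y∈t z∈t)) y∈c)))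
      ... | no empty = ≃-trans
        (content-empty ct₁ {cell A t ∩ᶜ c′} λ (x , x∈) → let (p , q) = ∧-true x∈ in
          empty (match x , true-∧ (into x t p) q))
        (≃-sym (content-empty ct₂ {cell B t ∩ᶜ c} empty))
      below : ∀ k t → length t ℕ.+ k ≡ d → m₁ (cell A t ∩ᶜ c′) ≃ m₂ (cell B t ∩ᶜ c)
      below zero t e = leaf t (trans (sym (ℕₚ.+-identityʳ (length t))) e)
      below (suc k) t e = ≃-trans (content-children A ct₁ t c′)
        (≃-trans (+-cong (below k (true ∷ t) (trans (sym (ℕₚ.+-suc (length t) k)) e))
                         (below k (false ∷ t) (trans (sym (ℕₚ.+-suc (length t) k)) e)))
          (≃-sym (content-children B ct₂ t c)))

    match-content : ∀ {m₁ m₂} → IsContent m₁ → IsContent m₂ →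
      (∀ t → m₁ (cell A t) ≃ m₂ (cell B t)) → ∀ c → m₁ (pullback match-continuous c) ≃ m₂ c
    match-content ct₁ ct₂ same c = match-content-at ct₁ ct₂ c d constant (λ t _ → same t)
      where
      uniform = locallyConstant⇒uniformlyConstant (χ c) (locallyConstant c)
      d = proj₁ (sep (proj₁ uniform))
      constant : ∀ t {y z} → length t ≡ d → _∈ᶜ_ B y t → _∈ᶜ_ B z t → χ c y ≡ χ c z
      constant t {y} {z} e y∈t z∈t = proj₂ uniform y z (proj₂ (sep (proj₁ uniform)) y z
        (subst (λ k → address B y k ≡ address B z k) e
          (trans (sym (address-unique B t y∈t)) (address-unique B t z∈t))))

  pointwise-cong : ∀ {f} → PointwiseContinuous f → ∀ {x y} → (∀ i → x i ≡ y i) → ∀ i → f x i ≡ f y i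
  pointwise-cong c {x} {y} e i = proj₂ (c x (suc i)) y (λ j _ → e j) i ℕₚ.≤-refl

  module MatchHomeo (A B : Scheme) (sepA : Separating A) (sepB : Separating B)
    (A⇒B : ∀ t → Nonempty (cell A t) → Nonempty (cell B t))
    (B⇒A : ∀ t → Nonempty (cell B t) → Nonempty (cell A t)) where

    module To = Match A B sepB A⇒B
    module From = Match B A sepA B⇒A

    private
      to∘from : ∀ y i → To.match (From.match y) i ≡ y i
      to∘from y = separating-≗ B sepB λ n → trans (To.match-address (From.match y) n) (From.match-address y n)

      from∘to : ∀ x i → From.match (To.match x) i ≡ x i
      from∘to x = separating-≗ A sepA λ n → trans (From.match-address (To.match x) n) (To.match-address x n)

    homeo : Homeo
    homeo = record
      { inverse = record
        { to = To.match
        ; from = From.match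
        ; to-cong = pointwise-cong To.match-continuous
        ; from-cong = pointwise-cong From.match-continuous
        ; inverse = (λ {y} {x} e i → trans (pointwise-cong To.match-continuous e i) (to∘from y i))
                  , (λ {x} {y} e i → trans (pointwise-cong From.match-continuous e i) (from∘to x i))
        }
      ; to-continuous = pointwise⇒continuous To.match-continuous
      ; from-continuous = pointwise⇒continuous From.match-continuous
      }

  -- Back and forth

  Refinement : (List Bool → Cl → Cl → Set) → List Bool → Cl → Cl → Set
  Refinement P t a b = Σ[ a′ ∈ Cl ] Σ[ b′ ∈ Cl ]
    (a′ ⊑ a × b′ ⊑ b × P (true ∷ t) a′ b′ × P (false ∷ t) (a ∖ᶜ a′) (b ∖ᶜ b′))

  -- Nodes carry the invariant `P` along with their two cells, because the choice of the next split
  -- depends on it.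
  module Refine (P : List Bool → Cl → Cl → Set) (root : P [] ⊤ᶜ ⊤ᶜ)
    (step : ∀ t {a b} → P t a b → Refinement P t a b) where

    private
      node : ∀ t → Σ[ a ∈ Cl ] Σ[ b ∈ Cl ] P t a b
      node []          = ⊤ᶜ , ⊤ᶜ , root
      node (true ∷ t)  =
        let (_ , _ , p) = node t
            (a′ , b′ , _ , _ , q , _) = step t p
        in a′ , b′ , q
      node (false ∷ t) =
        let (a , b , p) = node t
            (a′ , b′ , _ , _ , _ , q) = step t p
        in a ∖ᶜ a′ , b ∖ᶜ b′ , q

    abstract
      left right : Scheme
      left = record
        { cell       = λ t → proj₁ (node t)
        ; cell-root  = λ _ → refl
        ; cell-true  = λ t → let (_ , _ , ⊑a , _) = step t (proj₂ (proj₂ (node t))) in ⊑a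
        ; cell-false = λ _ _ → refl
        }
      right = record
        { cell       = λ t → proj₁ (proj₂ (node t))
        ; cell-root  = λ _ → refl
        ; cell-true  = λ t → let (_ , _ , _ , ⊑b , _) = step t (proj₂ (proj₂ (node t))) in ⊑b
        ; cell-false = λ _ _ → refl
        }

      related : ∀ t → P t (cell left t) (cell right t)
      related t = proj₂ (proj₂ (node t))

  Decides : Cl → ℕ → Set
  Decides a k = ∀ {x y} → χ a x ≡ true → χ a y ≡ true → x k ≡ y k

  ∖⊑ : ∀ a b → a ∖ᶜ b ⊑ a
  ∖⊑ a b x h = proj₁ (∧-true h)

  ∩⊑ : ∀ a b → a ∩ᶜ b ⊑ a
  ∩⊑ a b x h = proj₁ (∧-true h)

  decides-⊑ : ∀ {a b k} → a ⊑ b → Decides b k → Decides a k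
  decides-⊑ a⊑b d {x} {y} p q = d (a⊑b x p) (a⊑b y q)

  not-true : ∀ {b} → not b ≡ true → b ≡ false
  not-true {false} _ = refl

  decides-∩ : ∀ a k → Decides (a ∩ᶜ coordinate k) k
  decides-∩ a k {x} {y} p q =
    trans (proj₂ (∧-true {χ a x} p)) (sym (proj₂ (∧-true {χ a y} q)))

  decides-∖ : ∀ a k → Decides (a ∖ᶜ (a ∩ᶜ coordinate k)) k
  decides-∖ a k {x} {y} p q = trans (off x p) (sym (off y q))
    where
    off : ∀ x → χ (a ∖ᶜ (a ∩ᶜ coordinate k)) x ≡ true → x k ≡ false
    off x h with χ a x
    ... | true = not-true h

  data Side : Set where
    domain codomain : Side

  schedule : ℕ → Side × ℕ
  schedule zero    = domain , zero
  schedule (suc j) with schedule j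
  ... | domain   , k = codomain , k
  ... | codomain , k = domain , suc k

  schedule-codomain : ∀ {j k} → schedule j ≡ (domain , k) → schedule (suc j) ≡ (codomain , k)
  schedule-codomain e rewrite e = refl

  schedule-domain : ∀ {j k} → schedule j ≡ (codomain , k) → schedule (suc j) ≡ (domain , suc k)
  schedule-domain e rewrite e = refl

  schedule-surjective : ∀ s k → ∃[ j ] schedule j ≡ (s , k)
  schedule-surjective domain   zero    = 0 , refl
  schedule-surjective codomain zero    = 1 , refl
  schedule-surjective domain   (suc k) =
    let (j , e) = schedule-surjective codomain k in suc j , schedule-domain {j} e
  schedule-surjective codomain (suc k) =
    let (j , e) = schedule-surjective codomain k
    in suc (suc j) , schedule-codomain {suc j} (schedule-domain {j} e)

  side : Side → Cl → Cl → Cl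
  side domain   a b = a
  side codomain a b = b

  -- A back-and-forth system. It is used with equality of masses for conjugacy and with
  -- `EquiNonempty` for density.
  record Matchable (Q : Cl → Cl → Set) : Set where
    field
      Q-cong   : ∀ {a a′ b b′} → a ≗ᶜ a′ → b ≗ᶜ b′ → Q a b → Q a′ b′
      forth    : ∀ {a b} → Q a b → ∀ a′ → a′ ⊑ a →
                 Σ[ b′ ∈ Cl ] (b′ ⊑ b × Q a′ b′ × Q (a ∖ᶜ a′) (b ∖ᶜ b′))
      back     : ∀ {a b} → Q a b → ∀ b′ → b′ ⊑ b →
                 Σ[ a′ ∈ Cl ] (a′ ⊑ a × Q a′ b′ × Q (a ∖ᶜ a′) (b ∖ᶜ b′))
      inhabitˡ : ∀ {a b} → Q a b → Nonempty a → Nonempty b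
      inhabitʳ : ∀ {a b} → Q a b → Nonempty b → Nonempty a

  -- The first n levels of the two schemes are prescribed; afterwards the scheme
  -- on either side is refined in turn by one coordinate after the other.
  module BackAndForth {Q} (matchable : Matchable Q) (A₀ B₀ : Scheme) (n : ℕ)
    (start : ∀ t → length t ℕ.≤ n → Q (cell A₀ t) (cell B₀ t)) where

    open Matchable matchable

    private
      Prescribed : List Bool → Cl → Cl → Set
      Prescribed t a b = length t ℕ.≤ n → a ≗ᶜ cell A₀ t × b ≗ᶜ cell B₀ t

      Decided : List Bool → Cl → Cl → Set
      -- Entry `j` of the schedule is served when a node of depth `n + j` is split, so its effect
      -- holds from depth `n + j + 1` on.
      Decided t a b = ∀ j → n ℕ.+ j ℕ.< length t →
        Decides (side (proj₁ (schedule j)) a b) (proj₂ (schedule j))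

      P : List Bool → Cl → Cl → Set
      P t a b = Q a b × Prescribed t a b × Decided t a b

      root≗ : ∀ S → ⊤ᶜ ≗ᶜ cell S []
      root≗ S x = sym (cell-root S x)

      side-⊑ : ∀ s {a a′ b b′} → a′ ⊑ a → b′ ⊑ b → side s a′ b′ ⊑ side s a b
      side-⊑ domain   p q = p
      side-⊑ codomain p q = q

      Split : Side → ℕ → Cl → Cl → Set
      Split s k a b = Σ[ a′ ∈ Cl ] Σ[ b′ ∈ Cl ] (a′ ⊑ a × b′ ⊑ b × Q a′ b′ × Q (a ∖ᶜ a′) (b ∖ᶜ b′) ×
        Decides (side s a′ b′) k × Decides (side s (a ∖ᶜ a′) (b ∖ᶜ b′)) k)

      split : ∀ s k {a b} → Q a b → Split s k a b
      split domain k {a} {b} q =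
        let (b′ , ⊑b , q₁ , q₂) = forth q (a ∩ᶜ coordinate k) (∩⊑ a (coordinate k))
        in a ∩ᶜ coordinate k , b′ , ∩⊑ a (coordinate k) , ⊑b , q₁ , q₂ , decides-∩ a k , decides-∖ a k
      split codomain k {a} {b} q =
        let (a′ , ⊑a , q₁ , q₂) = back q (b ∩ᶜ coordinate k) (∩⊑ b (coordinate k))
        in a′ , b ∩ᶜ coordinate k , ⊑a , ∩⊑ b (coordinate k) , q₁ , q₂ , decides-∩ b k , decides-∖ b k

      decided-step : ∀ j′ t c a b {a′ b′} → n ℕ.+ j′ ≡ length t → a′ ⊑ a → b′ ⊑ b → Decided t a b →
        Decides (side (proj₁ (schedule j′)) a′ b′) (proj₂ (schedule j′)) → Decided (c ∷ t) a′ b′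
      decided-step j′ t c a b {a′} {b′} e ⊑a ⊑b old new j h with ℕₚ.m≤n⇒m<n∨m≡n (ℕₚ.≤-pred h)
      ... | inj₁ lt = decides-⊑ {side s a′ b′} {side s a b} (side-⊑ s {a} {a′} {b} {b′} ⊑a ⊑b) (old j lt)
        where s = proj₁ (schedule j)
      ... | inj₂ eq with ℕₚ.+-cancelˡ-≡ n j j′ (trans eq (sym e))
      ...   | refl = new

      ∖-congˡ : ∀ a a′ b → a ≗ᶜ a′ → a ∖ᶜ b ≗ᶜ a′ ∖ᶜ b
      ∖-congˡ a a′ b p x = cong (_∧ not (χ b x)) (p x)

      step : ∀ t {a b} → P t a b → Refinement P t a b
      step t {a} {b} (q , prescribed , decided) with length t ℕₚ.<? n
      ... | yes l<n =
        let (a≗ , b≗) = prescribed (ℕₚ.<⇒≤ l<n)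
            a′ = cell A₀ (true ∷ t)
            b′ = cell B₀ (true ∷ t)
            a∖≗ = λ x → trans (∖-congˡ a (cell A₀ t) a′ a≗ x) (sym (cell-false A₀ t x))
            b∖≗ = λ x → trans (∖-congˡ b (cell B₀ t) b′ b≗ x) (sym (cell-false B₀ t x))
        in a′ , b′ , (λ x h → trans (a≗ x) (cell-true A₀ t x h)) , (λ x h → trans (b≗ x) (cell-true B₀ t x h)) ,
           (start (true ∷ t) l<n , (λ _ → (λ _ → refl) , (λ _ → refl)) , early true a′ b′) ,
           (Q-cong (λ x → sym (a∖≗ x)) (λ x → sym (b∖≗ x)) (start (false ∷ t) l<n) ,
             (λ _ → a∖≗ , b∖≗) , early false (a ∖ᶜ a′) (b ∖ᶜ b′))
        where
        early : ∀ c a b → Decided (c ∷ t) a b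
        early c a b j h = ⊥-elim (ℕₚ.<-irrefl refl (ℕₚ.<-≤-trans (ℕₚ.<-≤-trans h l<n) (ℕₚ.m≤m+n n j)))
      ... | no l≮n =
        let j = length t ℕ.∸ n
            e = ℕₚ.m+[n∸m]≡n (ℕₚ.≮⇒≥ l≮n)
            (a′ , b′ , ⊑a , ⊑b , q₁ , q₂ , d₁ , d₂) = split (proj₁ (schedule j)) (proj₂ (schedule j)) q
        in a′ , b′ , ⊑a , ⊑b ,
           (q₁ , (λ l<n → ⊥-elim (l≮n l<n)) , decided-step j t true a b e ⊑a ⊑b decided d₁) ,
           (q₂ , (λ l<n → ⊥-elim (l≮n l<n)) ,
             decided-step j t false a b e (∖⊑ a a′) (∖⊑ b b′) decided d₂)

      open module R = Refine P
        (Q-cong (λ x → sym (root≗ A₀ x)) (λ x → sym (root≗ B₀ x)) (start [] ℕ.z≤n) ,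
          (λ _ → root≗ A₀ , root≗ B₀) , λ _ ())
        step using (related)

    A B : Scheme
    A = R.left
    B = R.right

    matched : ∀ t → Q (cell A t) (cell B t)
    matched t = proj₁ (related t)

    prescribedʳ : ∀ t → length t ℕ.≤ n → cell B t ≗ᶜ cell B₀ t
    prescribedʳ t h = proj₂ (proj₁ (proj₂ (related t)) h)

    prescribedˡ : ∀ t → length t ℕ.≤ n → cell A t ≗ᶜ cell A₀ t
    prescribedˡ t h = proj₁ (proj₁ (proj₂ (related t)) h)

    private
      separated : ∀ s (S : Scheme) → (∀ t → side s (cell A t) (cell B t) ≡ cell S t) → Separating S
      separated s S side≡ N = d , λ x y e i i<N →
        let t = address S x d
            (j , h) = schedule-surjective s i
        in decide x y e i i<N (proj₂ (schedule-surjective s i)) (λ l → proj₂ (proj₂ (related t)) (index i) l)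
        where
        index : ℕ → ℕ
        index i = proj₁ (schedule-surjective s i)
        -- At this depth the schedule has served every coordinate below `N` on side `s`; the
        -- successor meets the strict inequality in `Decided`.
        d = suc (n ℕ.+ maximum index N)
        decide : ∀ x y → address S x d ≡ address S y d → ∀ i → i ℕ.< N → schedule (index i) ≡ (s , i) →
          (n ℕ.+ index i ℕ.< length (address S x d) →
            Decides (side (proj₁ (schedule (index i))) (cell A (address S x d)) (cell B (address S x d)))
              (proj₂ (schedule (index i)))) → x i ≡ y i
        decide x y e i i<N eq dec rewrite eq | side≡ (address S x d) = dec
          (subst (n ℕ.+ index i ℕ.<_) (sym (length-address S x d)) (ℕ.s≤s (ℕₚ.+-monoʳ-≤ n (≤maximum index i<N))))
          (∈address S x d) (subst (λ t → χ (cell S t) y ≡ true) (sym e) (∈address S y d))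

    open MatchHomeo A B (separated domain A (λ _ → refl)) (separated codomain B (λ _ → refl))
      (λ t → inhabitˡ (matched t)) (λ t → inhabitʳ (matched t)) public

  EquiNonempty : Cl → Cl → Set
  EquiNonempty a b = (Nonempty a → Nonempty b) × (Nonempty b → Nonempty a)

  ∈∖ : ∀ a b {x} → χ a x ≡ true → ¬ (χ b x ≡ true) → χ (a ∖ᶜ b) x ≡ true
  ∈∖ a b p q = true-∧ p (cong not (¬true⇒false q))

  ∉∖ : ∀ a b {x} → χ (a ∖ᶜ b) x ≡ true → χ b x ≡ true → ⊥
  ∉∖ a b {x} p q with χ a x | χ b x
  ∉∖ a b {x} () refl | true | true

  -- Membership in `b` near `y` is decided by the first `n` coordinates, which leaves coordinate `n`
  -- itself free to take both values.
  proper-split : ∀ b → Nonempty b → ∃[ k ] (Nonempty (b ∩ᶜ coordinate k) × Nonempty (b ∖ᶜ (b ∩ᶜ coordinate k)))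
  proper-split b (y , y∈b) = n , (flip true , true-∧ (inside true) (at true)) ,
    (flip false , ∈∖ b (b ∩ᶜ coordinate n) (inside false) λ e →
      false≢true (at false) (proj₂ (∧-true {χ b (flip false)} e)))
    where
    n = proj₁ (locallyConstant b y)
    flip : Bool → 2^ℕ
    flip c i with i ℕₚ.≟ n
    ... | yes _ = c
    ... | no _  = y i
    at : ∀ c → flip c n ≡ c
    at c with n ℕₚ.≟ n
    ... | yes _ = refl
    ... | no h  = ⊥-elim (h refl)
    agree : ∀ c → y ≈[ n ] flip c
    agree c i i<n with i ℕₚ.≟ n
    ... | yes refl = ⊥-elim (ℕₚ.<-irrefl refl i<n)
    ... | no _     = refl
    inside : ∀ c → χ b (flip c) ≡ true
    inside c = trans (sym (proj₂ (locallyConstant b y) (flip c) (agree c))) y∈b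

  -- An empty `a′` is answered by the empty set and an empty remainder by all of `b`. Only when both
  -- parts are nonempty does `b` have to be split properly.
  equiNonempty-forth : ∀ {a b} → EquiNonempty a b → ∀ a′ → a′ ⊑ a →
    Σ[ b′ ∈ Cl ] (b′ ⊑ b × EquiNonempty a′ b′ × EquiNonempty (a ∖ᶜ a′) (b ∖ᶜ b′))
  equiNonempty-forth {a} {b} (f , g) a′ a′⊑a with em {P = Nonempty a′} | em {P = Nonempty (a ∖ᶜ a′)}
  ... | no ∅ | _ = ∅ᶜ , (λ _ ()) , ((λ h → ⊥-elim (∅ h)) , λ ()) ,
    (λ (x , h) → let (y , k) = f (x , ∖⊑ a a′ x h) in y , ∈∖ b ∅ᶜ k λ ()) ,
    (λ (y , k) → let (x , h) = g (y , ∖⊑ b ∅ᶜ y k) in x , ∈∖ a a′ h λ e → ∅ (x , e))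
  ... | yes _ | no ∅ = b , (λ _ h → h) ,
    ((λ (x , h) → f (x , a′⊑a x h)) ,
     (λ k → let (x , h) = g k in x , byContradiction λ x∉ → ∅ (x , ∈∖ a a′ h x∉))) ,
    (λ h → ⊥-elim (∅ h)) , λ (y , k) → ⊥-elim (∉∖ b b k (∖⊑ b b y k))
  ... | yes (x , x∈) | yes h =
    let (k , p , q) = proper-split b (f (x , a′⊑a x x∈))
    in b ∩ᶜ coordinate k , ∩⊑ b (coordinate k) , ((λ _ → p) , (λ _ → x , x∈)) , (λ _ → q) , λ _ → h

  equiNonempty-matchable : Matchable EquiNonempty
  equiNonempty-matchable = record
    { Q-cong = λ p q (f , g) →
        (λ (x , h) → let (y , k) = f (x , trans (p x) h) in y , trans (sym (q y)) k) ,
        (λ (y , k) → let (x , h) = g (y , trans (q y) k) in x , trans (sym (p x)) h)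
    ; forth = λ {a} {b} → equiNonempty-forth {a} {b}
    ; back = λ {a} {b} q b′ b′⊑b →
        let (a′ , a′⊑a , r , s) = equiNonempty-forth {b} {a} (swap q) b′ b′⊑b
        in a′ , a′⊑a , swap r , swap s
    ; inhabitˡ = proj₁
    ; inhabitʳ = proj₂
    }

  -- Homogeneous measures and their conjugacy classes

  continuous⇒pointwise : ∀ {f} → Continuous f → PointwiseContinuous f
  continuous⇒pointwise {f} c x n =
    let (m , h) = c _ (proj₁ (proj₂ ⟦ cylinder (f x) n ⟧)) (x∈cylinder (f x) n)
    in m , λ y e → ∈cylinder⇒≈[] (f x) n (f y) (h e)

  mass-⋆ : ∀ h μ (c : PointwiseContinuous (Homeo.to h)) a → mass ((h ^*) μ) a ≃ mass μ (pullback c a)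
  mass-⋆ h μ c a = measure-cong μ
    (preimage (Homeo.to-continuous h) (isOpen (proj₁ (proj₂ ⟦ a ⟧)))) (isOpen (proj₁ (proj₂ ⟦ pullback c a ⟧)))
    (id , id)

  mass-nonneg : ∀ μ a → ¬ (mass μ a ≺ 0ℝ)
  mass-nonneg μ a m≺0 = nonneg μ (isOpen (proj₁ (proj₂ ⟦ a ⟧))) (≺⇒< m≺0)

  module _ {m : Cl → ℝ} (ct : IsContent m) (pos : Positive m) where

    positive-nonneg : ∀ a → ¬ (m a ≺ 0ℝ)
    positive-nonneg a with em {P = Nonempty a}
    ... | yes h = ≺-asym (pos a h)
    ... | no ∅  = ≺-irrefl (content-empty ct {a} ∅)

  module Conjugacy (V : Pred ℝ 0ℓ) (groupLike : GroupLike V) where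

    open GroupLike groupLike
    open CountablyInfinite countablyInfinite public

    V-resp : ∀ {x y} → x ≃ y → x ∈ V → y ∈ V
    V-resp {x} {y} x≃y x∈V =
      let (n , e) = proj₁ enum-range x∈V
      in proj₂ enum-range (n , ≃⇒≈ (≃-trans (≃-sym x≃y) (≈⇒≃ {x} {enum n} e)))

    FS : Set₁
    FS = Setoid.Carrier (FullSpace V)

    massᶠ : FS → Cl → ℝ
    massᶠ ν = mass (proj₁ ν)

    mass∈V : ∀ (ν : FS) a → massᶠ ν a ∈ V
    mass∈V (ν , _ , values) a = values (⟦ a ⟧ , ≈-refl (ν ⟨ ⟦ a ⟧ ⟩))

    mass-positive : ∀ (ν : FS) → Positive (massᶠ ν)
    mass-positive (ν , full , _) = full⇒positive ν full

    _~_ : FS → FS → Set₁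
    _~_ = Setoid._≈_ (FullSpace V)

    same-mass⇒~ : ∀ {μ ν} → (∀ a → massᶠ μ a ≃ massᶠ ν a) → μ ~ ν
    same-mass⇒~ {μ , _} {ν , _} e b = ≃⇒≈ (mass-determines {μ} {ν} e b)

    ~⇒same-mass : ∀ {μ ν} → μ ~ ν → ∀ a → massᶠ μ a ≃ massᶠ ν a
    ~⇒same-mass e a = ≈⇒≃ (e (isOpen (proj₁ (proj₂ ⟦ a ⟧))))

    Homogeneous : (Cl → ℝ) → Set
    Homogeneous m = ∀ w {v} → v ∈ V → v ≺ m w → Σ[ w′ ∈ Cl ] (w′ ⊑ w × m w′ ≃ v)

    good⇒homogeneous : ∀ {μ} → IsGood μ → clopenValues μ ≐ V → Homogeneous (mass μ)
    good⇒homogeneous {μ} μ-good values w {v} v∈V v≺w =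
      let (U , v≈U) = proj₂ values v∈V
          (W , W⊆w , W≈U) = IsGood.good μ-good U ⟦ w ⟧ (≺⇒< (≺-respˡ (≈⇒≃ {v} {μ ⟨ U ⟩} v≈U) v≺w))
      in fromClopen W , (λ x h → W⊆w (proj₂ (fromClopen-≐ W) h)) ,
         ≃-trans (≃-sym (value-mass μ W)) (≃-trans (≈⇒≃ {μ ⟨ W ⟩} {μ ⟨ U ⟩} W≈U) (≃-sym (≈⇒≃ {v} {μ ⟨ U ⟩} v≈U)))

    -- Homogeneity provides parts of `b` only for values strictly below `m′ b`. For equality `b`
    -- itself serves, and `m a′` cannot exceed `m′ b` because `m` is nonnegative on the rest of `a`.
    -- The remainders match by cancellation.
    carve : ∀ {m m′ : Cl → ℝ} → IsContent m → IsContent m′ → (∀ a → ¬ (m a ≺ 0ℝ)) →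
      (∀ a → m a ∈ V) → Homogeneous m′ → ∀ {a b} → m a ≃ m′ b → ∀ a′ → a′ ⊑ a →
      Σ[ b′ ∈ Cl ] (b′ ⊑ b × m a′ ≃ m′ b′ × m (a ∖ᶜ a′) ≃ m′ (b ∖ᶜ b′))
    carve {m} {m′} ct ct′ m≥0 m∈V hom {a} {b} e a′ a′⊑a =
      let (b′ , b′⊑b , e′) = subset in b′ , b′⊑b , e′ , rest b′ b′⊑b e′
      where
      rest : ∀ b′ → b′ ⊑ b → m a′ ≃ m′ b′ → m (a ∖ᶜ a′) ≃ m′ (b ∖ᶜ b′)
      rest b′ b′⊑b e′ = +-cancelˡ (m a′) (≃-trans (≃-sym (content-⊑ ct {a′} {a} a′⊑a))
        (≃-trans e (≃-trans (content-⊑ ct′ {b′} {b} b′⊑b) (+-cong (≃-sym e′) ≃-refl))))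
      subset : Σ[ b′ ∈ Cl ] (b′ ⊑ b × m a′ ≃ m′ b′)
      subset with compareℝ (m a′) (m′ b)
      ... | inj₁ lt = let (b′ , b′⊑b , e′) = hom b (m∈V a′) lt in b′ , b′⊑b , ≃-sym e′
      ... | inj₂ (inj₁ eq) = b , (λ _ h → h) , eq
      ... | inj₂ (inj₂ gt) = ⊥-elim (contra (compareℝ (m (a ∖ᶜ a′)) 0ℝ))
        where
        a≺a′ : m a ≺ m a′
        a≺a′ = ≺-respˡ (≃-sym e) gt
        a≃ : m a ≃ m a′ + m (a ∖ᶜ a′)
        a≃ = content-⊑ ct {a′} {a} a′⊑a
        contra : m (a ∖ᶜ a′) ≺ 0ℝ ⊎ m (a ∖ᶜ a′) ≃ 0ℝ ⊎ 0ℝ ≺ m (a ∖ᶜ a′) → ⊥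
        contra (inj₁ lt) = m≥0 (a ∖ᶜ a′) lt
        contra (inj₂ (inj₁ eq)) = ≺-irrefl (≃-trans a≃ (≃-trans (+-cong ≃-refl eq) (+-identityʳ (m a′)))) a≺a′
        contra (inj₂ (inj₂ gt)) = ≺-asym a≺a′ (content-positive-difference ct {a′} {a} a′⊑a gt)

    -- A content with values in V is realised by a continuous image of μ: the
    -- preimages of the cylinders are carved out of the space one after another.
    module Realise (μ : FS) (μ-hom : Homogeneous (massᶠ μ))
      {m : Cl → ℝ} (ct : IsContent m) (pos : Positive m) (m∈V : ∀ a → m a ∈ V) where

      private
        P : List Bool → Cl → Cl → Set
        P t a b = b ≗ᶜ cell cylinders t × m b ≃ massᶠ μ a

        μ-ct = mass-content (proj₁ μ)

        step : ∀ t {a b} → P t a b → Refinement P t a b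
        step t {a} {b} (b≗ , e) =
          let b′ = cell cylinders (true ∷ t)
              b′⊑b = λ x h → trans (b≗ x) (cell-true cylinders t x h)
              (a′ , a′⊑a , e₁ , e₂) = carve ct μ-ct (positive-nonneg ct pos) m∈V μ-hom {b} {a} e b′ b′⊑b
          in a′ , b′ , a′⊑a , b′⊑b , ((λ _ → refl) , e₁) ,
             ((λ x → trans (cong (_∧ not (χ b′ x)) (b≗ x)) (sym (cell-false cylinders t x))) , e₂)

      open Refine P ((λ _ → refl) , ≃-trans (content-total ct) (≃-sym (content-total μ-ct))) step public

      right≗cylinders : ∀ t → cell right t ≗ᶜ cell cylinders t
      right≗cylinders t = proj₁ (related t)

      mass-left : ∀ t → massᶠ μ (cell left t) ≃ m (cell right t)
      mass-left t = ≃-sym (proj₂ (related t))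

      right-agree : ∀ {x y} t → χ (cell right t) x ≡ true → χ (cell right t) y ≡ true → x ≈[ length t ] y
      right-agree {x} {y} t p q = cylinders-agree (length t)
        (trans (sym (address-unique cylinders t (trans (sym (right≗cylinders t x)) p)))
               (address-unique cylinders t (trans (sym (right≗cylinders t y)) q)))

      private
        separating : Separating right
        separating n = n , λ x y e → subst (x ≈[_] y) (length-address right x n)
          (right-agree (address right x n) (∈address right x n)
            (subst (λ t → χ (cell right t) y ≡ true) (sym e) (∈address right y n)))

        right-nonempty : ∀ t → Nonempty (cell right t)
        right-nonempty t = let (x , h) = cylinders-nonempty t in x , trans (right≗cylinders t x) h

      -- Positivity of `m` gives each carved cell positive mass, so no branch of the carved tree
      -- dies out.
      left⇔right : ∀ t → EquiNonempty (cell left t) (cell right t)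
      left⇔right t = (λ _ → right-nonempty t) , λ h →
        content-positive⇒nonempty μ-ct {cell left t} (≺-respʳ (≃-sym (mass-left t)) (pos (cell right t) h))

      private
        -- The carved cells need not separate points, so the map is continuous but may fail to be
        -- injective.
        module M = Match left right separating (λ t → proj₁ (left⇔right t))

        image : ProbabilityMeasure
        image = pushforward (proj₁ μ) (pointwise⇒continuous M.match-continuous)

        mass-image : ∀ a → mass image a ≃ m a
        mass-image a = ≃-trans (mass-pushforward (proj₁ μ) M.match-continuous a)
          (M.match-content μ-ct ct mass-left a)

      realisation : FS
      realisation = image , (λ {U} → positive⇒full image (λ a h → ≺-respʳ (≃-sym (mass-image a)) (pos a h)) {U}) ,
        λ (U , r≈U) → V-resp
          (≃-sym (≃-trans (≈⇒≃ r≈U) (≃-trans (value-mass image U) (mass-image (fromClopen U)))))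
          (m∈V (fromClopen U))

      mass-realisation : ∀ a → massᶠ realisation a ≃ m a
      mass-realisation = mass-image

    -- A set with modulus `n` is a union of cylinders of level `n`, so it is enough that the carved
    -- cells have the right masses at this one level.
    approximate : ∀ (μ : FS) → Homogeneous (massᶠ μ) → ∀ (ν : FS) n →
      Σ[ h ∈ Homeo ] ∀ a → UniformlyConstant (χ a) n → massᶠ (act V h μ) a ≃ massᶠ ν a
    approximate μ μ-hom ν n = homeo , λ a uc → ≃-trans (mass-⋆ homeo (proj₁ μ) To.match-continuous a)
      (To.match-content-at (mass-content (proj₁ μ)) (mass-content (proj₁ ν)) a n
        (λ t {y} {z} e p q → uc y z (subst (y ≈[_] z) e (right-agree t
          (trans (sym (prescribedʳ t (ℕₚ.≤-reflexive e) y)) p)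
          (trans (sym (prescribedʳ t (ℕₚ.≤-reflexive e) z)) q))))
        (λ t e → ≃-trans (content-cong (mass-content (proj₁ μ)) (prescribedˡ t (ℕₚ.≤-reflexive e)))
          (≃-trans (mass-left t)
            (≃-sym (content-cong (mass-content (proj₁ ν)) (prescribedʳ t (ℕₚ.≤-reflexive e)))))))
      where
      open Realise μ μ-hom (mass-content (proj₁ ν)) (mass-positive ν) (mass∈V ν)
      open BackAndForth equiNonempty-matchable left right n (λ t _ → left⇔right t)

    -- Going forth carves clopen sets for `ν` and going back carves them for `μ`, so each direction
    -- draws on the homogeneity of one measure.
    homogeneous⇒conjugate : ∀ (μ ν : FS) → Homogeneous (massᶠ μ) → Homogeneous (massᶠ ν) → ν ∈ conjugacyClass V μ
    homogeneous⇒conjugate μ ν μ-hom ν-hom = homeo , same-mass⇒~ {ν} {act V homeo μ} λ a → ≃-sym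
      (≃-trans (mass-⋆ homeo (proj₁ μ) To.match-continuous a) (To.match-content μ-ct ν-ct matched a))
      where
      μ-ct = mass-content (proj₁ μ)
      ν-ct = mass-content (proj₁ ν)
      inhabit : ∀ (μ ν : FS) {a b} → massᶠ μ a ≃ massᶠ ν b → Nonempty a → Nonempty b
      inhabit μ ν {a} {b} e h = content-positive⇒nonempty (mass-content (proj₁ ν)) {b}
        (≺-respʳ e (mass-positive μ a h))
      matchable : Matchable (λ a b → massᶠ μ a ≃ massᶠ ν b)
      matchable = record
        { Q-cong = λ p q e → ≃-trans (≃-sym (content-cong μ-ct p)) (≃-trans e (content-cong ν-ct q))
        ; forth = λ {a} {b} → carve μ-ct ν-ct (mass-nonneg (proj₁ μ)) (mass∈V μ) ν-hom {a} {b}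
        ; back = λ {a} {b} e b′ b′⊑b →
            let (a′ , a′⊑a , e₁ , e₂) = carve ν-ct μ-ct (mass-nonneg (proj₁ ν)) (mass∈V ν) μ-hom {b} {a} (≃-sym e) b′ b′⊑b
            in a′ , a′⊑a , ≃-sym e₁ , ≃-sym e₂
        ; inhabitˡ = λ {a} {b} → inhabit μ ν {a} {b}
        ; inhabitʳ = λ {a} {b} e → inhabit ν μ {b} {a} (≃-sym e)
        }
      -- With `n` equal to 0 only the root of `cylinders` enters, and there both masses are 1.
      start : ∀ t → length t ℕ.≤ 0 → massᶠ μ (cell cylinders t) ≃ massᶠ ν (cell cylinders t)
      start [] _ = ≃-trans (content-total μ-ct) (≃-sym (content-total ν-ct))
      open BackAndForth matchable cylinders cylinders 0 start

    conjugate⇒homogeneous : ∀ (μ ν : FS) → Homogeneous (massᶠ μ) → ν ∈ conjugacyClass V μ → Homogeneous (massᶠ ν)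
    conjugate⇒homogeneous μ ν μ-hom (h , ν~hμ) w {v} v∈V v≺w =
      let (u , u⊑w , e) = μ-hom (pullback c w) v∈V (≺-respʳ (mass-ν w) v≺w)
      in pullback d u ,
         (λ y p → trans (χ-resp w (λ i → sym (strictlyInverseˡ y i))) (u⊑w (from y) p)) ,
         ≃-trans (mass-ν (pullback d u)) (≃-trans
           (content-cong (mass-content (proj₁ μ)) λ x → χ-resp u (strictlyInverseʳ x)) e)
      where
      open Homeo h
      open Inverse inverse using (strictlyInverseʳ)
      c : PointwiseContinuous to
      c = continuous⇒pointwise to-continuous
      d : PointwiseContinuous from
      d = continuous⇒pointwise from-continuous
      mass-ν : ∀ a → massᶠ ν a ≃ massᶠ μ (pullback c a)
      mass-ν a = ≃-trans (~⇒same-mass {ν} {act V h μ} ν~hμ a) (mass-⋆ h (proj₁ μ) c a)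

  -- The strong topology

  -- This is 1/(n+1), as `mkℚ` takes the denominator minus one.
  radius : ℕ → ℚ
  radius n = mkℚ (ℤ.+ 1) n (1-coprimeTo (suc n))

  radius-anti : ∀ {m n} → m ℕ.< n → radius n ℚ.< radius m
  radius-anti m<n = ℚ.*<* (ℤₚ.*-monoˡ-<-pos (ℤ.+ 1) (ℤ.+<+ (ℕ.s≤s m<n)))

  radius-cancel : ∀ {m n} → radius n ℚ.< radius m → m ℕ.< n
  radius-cancel {m} {n} h with m ℕₚ.<? n
  ... | yes m<n = m<n
  ... | no m≮n with ℕₚ.m≤n⇒m<n∨m≡n (ℕₚ.≮⇒≥ m≮n)
  ...   | inj₁ n<m  = ⊥-elim (ℚₚ.<-asym h (radius-anti n<m))
  ...   | inj₂ refl = ⊥-elim (ℚₚ.<-irrefl refl h)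

  radius-positive : ∀ n → 0ℚ ℚ.< radius n
  radius-positive n = ℚ.*<* (ℤ.+<+ (ℕ.s≤s ℕ.z≤n))

  radius-archimedean : ∀ {δ} → 0ℚ ℚ.< δ → ∃[ n ] radius n ℚ.< δ
  -- Here δ = (p+1)/(d+1) ≥ 1/(d+1) > 1/(d+2), and the last is `radius (suc d)`.
  radius-archimedean {mkℚ (ℤ.+ suc p) d _} _ = suc d , ℚ.*<* (ℤ.+<+ bound)
    where
    bound : 1 ℕ.* suc d ℕ.< suc p ℕ.* suc (suc d)
    bound = ℕₚ.≤-trans (ℕ.s≤s (ℕₚ.≤-reflexive (ℕₚ.*-identityˡ (suc d)))) (ℕₚ.m≤m+n (suc (suc d)) (p ℕ.* suc (suc d)))
  radius-archimedean {mkℚ (ℤ.+ 0) d _} (ℚ.*<* (ℤ.+<+ ()))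
  radius-archimedean {mkℚ (ℤ.-[1+ p ]) d _} (ℚ.*<* ())

  digit : ℕ → ℕ → ℕ
  digit m zero    = proj₁ (unpair m)
  digit m (suc i) = digit (proj₂ (unpair m)) i

  digit-surjective : ∀ n (f : ℕ → ℕ) → ∃[ m ] ∀ i → i ℕ.< n → digit m i ≡ f i
  digit-surjective zero f = 0 , λ _ ()
  digit-surjective (suc n) f =
    let (m , h) = digit-surjective n (f ∘ suc)
        (k , e) = unpair-surjective (f 0) m
    in k , λ { zero _ → cong proj₁ e
             ; (suc i) i<n → trans (cong (λ p → digit (proj₂ p) i) e) (h i (ℕₚ.≤-pred i<n)) }

  inverseHomeo : Homeo → Homeo
  inverseHomeo h = record
    { inverse = record
      { to = from ; from = to
      ; to-cong = Inverse.from-cong inverse ; from-cong = Inverse.to-cong inverse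
      ; inverse = swap (Inverse.inverse inverse) }
    ; to-continuous = from-continuous
    ; from-continuous = to-continuous
    }
    where open Homeo h

  module Strong (V : Pred ℝ 0ℓ) (groupLike : GroupLike V) where

    open Conjugacy V groupLike public

    -- For fixed `μ` these are the basic strong neighbourhoods, indexed by a single number instead
    -- of a list of clopen sets. The record lets the two measures be inferred.
    record Agree (n : ℕ) (μ ν : FS) : Set where
      constructor agree
      field agreeAt : ∀ k → k ℕ.< n → massᶠ μ (code k) ≃ massᶠ ν (code k)
    open Agree

    agree-sym : ∀ {n μ ν} → Agree n μ ν → Agree n ν μ
    agree-sym h = agree λ k k<n → ≃-sym (agreeAt h k k<n)

    agree-trans : ∀ {n μ ν ρ} → Agree n μ ν → Agree n ν ρ → Agree n μ ρ
    agree-trans h h′ = agree λ k k<n → ≃-trans (agreeAt h k k<n) (agreeAt h′ k k<n)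

    agree-weaken : ∀ {m n μ ν} → m ℕ.≤ n → Agree n μ ν → Agree m μ ν
    agree-weaken m≤n h = agree λ k k<m → agreeAt h k (ℕₚ.<-≤-trans k<m m≤n)

    mass-code : ∀ (ν : FS) a k → code k ≗ᶜ a → massᶠ ν (code k) ≃ massᶠ ν a
    mass-code ν a k e = content-cong (mass-content (proj₁ ν)) {code k} {a} e

    agree⇒same-mass : ∀ {μ ν} a → Agree (suc (proj₁ (code-surjective a))) μ ν → massᶠ μ a ≃ massᶠ ν a
    agree⇒same-mass {μ} {ν} a h = let (k , e) = code-surjective a in
      ≃-trans (≃-sym (mass-code μ a k e)) (≃-trans (agreeAt h k ℕₚ.≤-refl) (mass-code ν a k e))

    agree⇒~ : ∀ {μ ν} → (∀ n → Agree n μ ν) → μ ~ ν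
    agree⇒~ {μ} {ν} h = same-mass⇒~ {μ} {ν} λ a → agree⇒same-mass a (h _)

    ~⇒agree : ∀ {μ ν} → μ ~ ν → ∀ n → Agree n μ ν
    ~⇒agree {μ} {ν} e n = agree λ k _ → ~⇒same-mass {μ} {ν} e (code k)

    AgreeOpen : Pred FS (lsuc 0ℓ) → Set₁
    AgreeOpen O = ∀ {μ} → μ ∈ O → ∃[ n ] (∀ {ν} → Agree n μ ν → ν ∈ O)

    open Topology using (Open)

    private
      codes : ℕ → List Clopen
      codes zero    = []
      codes (suc n) = ⟦ code n ⟧ ∷ codes n

      codes-agree : ∀ n {μ ν : FS} → All (λ U → proj₁ ν ⟨ U ⟩ ≈ proj₁ μ ⟨ U ⟩) (codes n) → Agree n μ ν
      codes-agree zero _ = agree λ _ ()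
      codes-agree (suc n) {μ} {ν} (e ∷ es) = agree at
        where
        at : ∀ k → k ℕ.< suc n → massᶠ μ (code k) ≃ massᶠ ν (code k)
        at k (ℕ.s≤s k≤n) with ℕₚ.m≤n⇒m<n∨m≡n k≤n
        ... | inj₁ k<n  = agreeAt (codes-agree n {μ} {ν} es) k k<n
        ... | inj₂ refl = ≃-sym (≈⇒≃ e)

      agree-list : ∀ (i : List Clopen) → ∃[ n ] ∀ {μ ν : FS} → Agree n μ ν →
        All (λ U → proj₁ ν ⟨ U ⟩ ≈ proj₁ μ ⟨ U ⟩) i
      agree-list [] = 0 , λ _ → []
      agree-list (U ∷ i) = suc k ℕ.⊔ n , λ {μ} {ν} g →
        ≃⇒≈ (≃-trans (value-mass (proj₁ ν) U) (≃-trans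
          (≃-sym (agree⇒same-mass (fromClopen U) (agree-weaken (ℕₚ.m≤m⊔n (suc k) n) g)))
          (≃-sym (value-mass (proj₁ μ) U)))) ∷
        h {μ} {ν} (agree-weaken (ℕₚ.m≤n⊔m (suc k) n) g)
        where
        k = proj₁ (code-surjective (fromClopen U))
        n = proj₁ (agree-list i)
        h : ∀ {μ ν : FS} → Agree n μ ν → All (λ U → proj₁ ν ⟨ U ⟩ ≈ proj₁ μ ⟨ U ⟩) i
        h = proj₂ (agree-list i)

    strong⇒agree : ∀ O → Open (strong V) O → AgreeOpen O
    strong⇒agree O o {μ} μ∈O =
      let (i , N⊆O) = o {μ} μ∈O
          (n , h) = agree-list i
      in n , λ {ν} g → N⊆O {ν} (h g)

    agree⇒strong : ∀ O → AgreeOpen O → Open (strong V) O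
    agree⇒strong O o {μ} μ∈O = let (n , h) = o {μ} μ∈O in codes n , λ {ν} es → h {ν} (codes-agree n {μ} {ν} es)

    strong-finer : strong V FinerThan weak*Full V
    strong-finer O (O′ , o , O⊆ , ⊆O) {μ} μ∈O =
      let (i , N⊆O′) = o {proj₁ μ} (O⊆ {μ} μ∈O)
      in map proj₁ i , λ {ν} es → ⊆O {ν} (N⊆O′ {proj₁ ν} (All.map
           (λ {(U , ε , 0<ε)} e → ≈⇒∣-∣<ε (proj₁ μ ⟨ U ⟩) (proj₁ ν ⟨ U ⟩) ε
             (≈-sym (proj₁ ν ⟨ U ⟩) (proj₁ μ ⟨ U ⟩) e) 0<ε)
           (map⁻ es)))

    private
      -- On the first `n` codes a measure takes finitely many values in the countable set V,
      -- recorded as digits of `m`. One measure for each table that occurs gives a countable dense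
      -- set.
      Known : ℕ → ℕ → Set₁
      Known n m = Σ[ ν ∈ FS ] ∀ i → i ℕ.< n → massᶠ ν (code i) ≃ enum (digit m i)

      known : ℕ → ℕ → Maybe FS
      known n m with em {P = Known n m}
      ... | yes (ν , _) = just ν
      ... | no _        = nothing

      known-spec : ∀ n m → Known n m → Σ[ ν ∈ FS ] (known n m ≡ just ν × ∀ i → i ℕ.< n → massᶠ ν (code i) ≃ enum (digit m i))
      known-spec n m k with em {P = Known n m}
      ... | yes (ν , h) = ν , refl , h
      ... | no ¬k       = ⊥-elim (¬k k)

    strong-separable : Separable (strong V)
    strong-separable = (λ k → known (proj₁ (unpair k)) (proj₂ (unpair k))) , λ O o (μ , μ∈O) →
      let (n , h) = strong⇒agree O o {μ} μ∈O
          index = λ i → proj₁ (proj₁ enum-range (mass∈V μ (code i)))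
          (m , digits) = digit-surjective n index
          value : ∀ i → i ℕ.< n → massᶠ μ (code i) ≃ enum (digit m i)
          value i i<n = subst (λ j → massᶠ μ (code i) ≃ enum j) (sym (digits i i<n))
            (≈⇒≃ (proj₂ (proj₁ enum-range (mass∈V μ (code i)))))
          (k , e) = unpair-surjective n m
          (ν , eq , spec) = known-spec n m (μ , value)
      in k , ν , trans (cong (λ p → known (proj₁ p) (proj₂ p)) e) eq ,
         h {ν} (agree λ i i<n → ≃-trans (value i i<n) (≃-sym (spec i i<n)))

    private
      firstDisagreement : ∀ {μ ν} n → ¬ Agree n μ ν → ∃[ N ] (Agree N μ ν × ¬ Agree (suc N) μ ν)
      firstDisagreement zero ¬h = ⊥-elim (¬h (agree λ _ ()))
      firstDisagreement {μ} {ν} (suc n) ¬h with em {P = Agree n μ ν}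
      ... | yes h  = n , h , ¬h
      ... | no ¬h′ = firstDisagreement {μ} {ν} n ¬h′

    -- The ultrametric of a countable product of discrete spaces: 1/(N+1) for the first code `N` of
    -- disagreement. The relation exposes the cases that `distance` hides behind excluded middle.
    Distance : FS → FS → ℚ → Set
    Distance μ ν q = (q ≡ 0ℚ × (∀ n → Agree n μ ν)) ⊎
      (∃[ N ] (q ≡ radius N × Agree N μ ν × ¬ Agree (suc N) μ ν))

    distance : ∀ μ ν → ∃[ q ] Distance μ ν q
    distance μ ν with em {P = ∀ n → Agree n μ ν}
    ... | yes h = 0ℚ , inj₁ (refl , h)
    ... | no ¬h =
      let (n , ¬hn) = someDisagreement
          (N , h , ¬h′) = firstDisagreement {μ} {ν} n ¬hn
      in radius N , inj₂ (N , refl , h , ¬h′)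
      where
      someDisagreement : ∃[ n ] (¬ Agree n μ ν)
      someDisagreement = byContradiction λ none → ¬h λ n → byContradiction λ ¬hn → none (n , ¬hn)

    private
      distance-unique : ∀ {μ ν p q} → Distance μ ν p → Distance μ ν q → p ≡ q
      distance-unique (inj₁ (refl , _)) (inj₁ (refl , _)) = refl
      distance-unique (inj₁ (_ , h)) (inj₂ (N , _ , _ , ¬h)) = ⊥-elim (¬h (h (suc N)))
      distance-unique (inj₂ (N , _ , _ , ¬h)) (inj₁ (_ , h)) = ⊥-elim (¬h (h (suc N)))
      distance-unique {μ} {ν} (inj₂ (M , refl , g , ¬g)) (inj₂ (N , refl , h , ¬h)) with ℕₚ.<-cmp M N
      ... | tri< M<N _ _ = ⊥-elim (¬g (agree-weaken M<N h))
      ... | tri≈ _ refl _ = refl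
      ... | tri> _ _ N<M = ⊥-elim (¬h (agree-weaken N<M g))

      distance-sym : ∀ {μ ν q} → Distance μ ν q → Distance ν μ q
      distance-sym {μ} {ν} (inj₁ (e , h)) = inj₁ (e , λ n → agree-sym (h n))
      distance-sym {μ} {ν} (inj₂ (N , e , h , ¬h)) =
        inj₂ (N , e , agree-sym h , λ k → ¬h (agree-sym k))

      close⇒agree : ∀ {μ ν q} n → Distance μ ν q → q ℚ.< radius n → Agree (suc n) μ ν
      close⇒agree n (inj₁ (_ , h)) _ = h (suc n)
      close⇒agree {μ} {ν} n (inj₂ (N , refl , h , _)) lt = agree-weaken (radius-cancel lt) h

      agree⇒close : ∀ {μ ν q} n → Distance μ ν q → Agree n μ ν → q ℚ.≤ radius n
      agree⇒close n (inj₁ (refl , _)) _ = ℚₚ.<⇒≤ (radius-positive n)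
      agree⇒close {μ} {ν} n (inj₂ (N , refl , _ , ¬h)) g with ℕₚ.<-cmp N n
      ... | tri< N<n _ _  = ⊥-elim (¬h (agree-weaken N<n g))
      ... | tri≈ _ refl _ = ℚₚ.≤-refl
      ... | tri> _ _ n<N  = ℚₚ.<⇒≤ (radius-anti n<N)

      distance-nonneg : ∀ {μ ν q} → Distance μ ν q → 0ℚ ℚ.≤ q
      distance-nonneg (inj₁ (refl , _)) = ℚₚ.≤-refl
      distance-nonneg (inj₂ (N , refl , _)) = ℚₚ.<⇒≤ (radius-positive N)

      -- If `p + q` were below 1/(N+1), then so would be `p` and `q`; both pairs would agree on code
      -- `N`, and hence `μ` and `ρ` too.
      distance-triangle : ∀ {μ ν ρ p q r} → Distance μ ν p → Distance ν ρ q → Distance μ ρ r →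
        ¬ (p ℚ.+ q ℚ.< r)
      distance-triangle {p = p} {q} dp dq (inj₁ (refl , _)) lt =
        ℚₚ.<-irrefl refl (ℚₚ.≤-<-trans (ℚₚ.+-mono-≤ (distance-nonneg dp) (distance-nonneg dq)) lt)
      distance-triangle {μ} {ν} {ρ} {p} {q} dp dq (inj₂ (N , refl , _ , ¬h)) lt =
        ¬h (agree-trans 
          (close⇒agree {μ} {ν} N dp (ℚₚ.≤-<-trans p≤p+q lt)) (close⇒agree {ν} {ρ} N dq (ℚₚ.≤-<-trans q≤p+q lt)))
        where
        p≤p+q : p ℚ.≤ p ℚ.+ q
        p≤p+q = subst (ℚ._≤ p ℚ.+ q) (ℚₚ.+-identityʳ p) (ℚₚ.+-monoʳ-≤ p (distance-nonneg dq))
        q≤p+q : q ℚ.≤ p ℚ.+ q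
        q≤p+q = subst (ℚ._≤ p ℚ.+ q) (ℚₚ.+-identityˡ q) (ℚₚ.+-monoˡ-≤ q (distance-nonneg dp))

      dist : FS → FS → ℝ
      dist μ ν = fromℚ (proj₁ (distance μ ν))

      dist-0 : ∀ μ ν → dist μ ν ≈ 0ℝ ⇔ μ ~ ν
      dist-0 μ ν = mk⇔ to from
        where
        zero⇒~ : ∀ {q} → Distance μ ν q → fromℚ q ≈ 0ℝ → μ ~ ν
        zero⇒~ (inj₁ (_ , h)) _ = agree⇒~ {μ} {ν} h
        zero⇒~ (inj₂ (N , refl , _)) e = ⊥-elim (≺-irrefl (≃-sym (≈⇒≃ e)) (fromℚ-mono (radius-positive N)))
        to : dist μ ν ≈ 0ℝ → μ ~ ν
        to = zero⇒~ (proj₂ (distance μ ν))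
        from : μ ~ ν → dist μ ν ≈ 0ℝ
        from e = subst (λ q → fromℚ q ≈ 0ℝ)
          (distance-unique {μ} {ν} (inj₁ (refl , ~⇒agree {μ} {ν} e)) (proj₂ (distance μ ν))) (≈-refl 0ℝ)

    strongMetric : Metric (FullSpace V)
    strongMetric = record
      { dist     = dist
      ; dist-0   = dist-0
      ; dist-sym = λ μ ν → subst (λ q → dist μ ν ≈ fromℚ q)
          (distance-unique {ν} {μ} (distance-sym {μ} {ν} (proj₂ (distance μ ν))) (proj₂ (distance ν μ)))
          (≈-refl (dist μ ν))
      ; triangle = λ μ ν ρ lt → distance-triangle {μ} {ν} {ρ}
          (proj₂ (distance μ ν)) (proj₂ (distance ν ρ)) (proj₂ (distance μ ρ))
          (fromℚ-cancel {proj₁ (distance μ ν) ℚ.+ proj₁ (distance ν ρ)} {proj₁ (distance μ ρ)} (<⇒≺ lt))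
      }

    private
      dist<⇒agree : ∀ μ ν n → dist μ ν < fromℚ (radius n) → Agree (suc n) μ ν
      dist<⇒agree μ ν n lt = close⇒agree {μ} {ν} n (proj₂ (distance μ ν)) (fromℚ-cancel (<⇒≺ lt))

      agree⇒dist< : ∀ {ε} → 0ℝ < ε → ∃[ n ] ∀ {μ ν} → Agree n μ ν → dist μ ν < ε
      agree⇒dist< {ε} 0<ε =
        let (δ , 0<δ , δ≺ε) = rational-below {ε} (<⇒≺ 0<ε)
            (n , n<δ) = radius-archimedean 0<δ
        in n , λ {μ} {ν} g → ≺⇒< (≺-trans
             (fromℚ-mono (ℚₚ.≤-<-trans (agree⇒close {μ} {ν} n (proj₂ (distance μ ν)) g) n<δ)) δ≺ε)

      0<radius : ∀ n → 0ℝ < fromℚ (radius n)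
      0<radius n = ≺⇒< (fromℚ-mono (radius-positive n))

    strong⇔metric : ∀ O → Open (strong V) O ⇔ MetricOpen (FullSpace V) strongMetric O
    strong⇔metric O = mk⇔ to from
      where
      to : Open (strong V) O → MetricOpen (FullSpace V) strongMetric O
      to o {μ} μ∈O =
        let (n , h) = strong⇒agree O o {μ} μ∈O
        in fromℚ (radius n) , 0<radius n , λ {ν} lt →
             h {ν} (agree-weaken (ℕₚ.n≤1+n n) (dist<⇒agree μ ν n lt))
      from : MetricOpen (FullSpace V) strongMetric O → Open (strong V) O
      from o = agree⇒strong O λ {μ} μ∈O →
        let (ε , 0<ε , B⊆O) = o {μ} μ∈O
            (n , h) = agree⇒dist< {ε} 0<ε
        in n , λ {ν} g → B⊆O {ν} (h {μ} {ν} g)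

    module _ (μ : FS) (μ-hom : Homogeneous (massᶠ μ)) where

      private
        -- The mass of each clopen set is eventually constant along s.
        module Limit (s : ℕ → FS) (stable : ∀ n → ∃[ N ] ∀ i j → N ℕ.≤ i → N ℕ.≤ j → Agree n (s i) (s j)) where

          time : Cl → ℕ
          time a = proj₁ (stable (suc (proj₁ (code-surjective a))))

          m : Cl → ℝ
          m a = massᶠ (s (time a)) a

          eventually : ∀ a i → time a ℕ.≤ i → m a ≃ massᶠ (s i) a
          eventually a i h = agree⇒same-mass {s (time a)} {s i} a
            (proj₂ (stable (suc (proj₁ (code-surjective a)))) (time a) i ℕₚ.≤-refl h)

          ct : ∀ i → IsContent (massᶠ (s i))
          ct i = mass-content (proj₁ (s i))

          -- Each law involves finitely many clopen sets, and on these `m` coincides with an actual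
          -- measure `s i` at a late enough index.
          m-content : IsContent m
          m-content = record
            { content-cong = λ {a} {b} e →
                let i = time a ℕ.⊔ time b
                in ≃-trans (eventually a i (ℕₚ.m≤m⊔n _ _)) (≃-trans (content-cong (ct i) e)
                     (≃-sym (eventually b i (ℕₚ.m≤n⊔m (time a) _))))
            ; content-split = λ a b →
                let j = time (a ∩ᶜ b) ℕ.⊔ time (a ∖ᶜ b)
                    i = time a ℕ.⊔ j
                    j≤i = ℕₚ.m≤n⊔m (time a) j
                in ≃-trans (eventually a i (ℕₚ.m≤m⊔n _ _)) (≃-trans (content-split (ct i) a b) (≃-sym (+-cong
                     (eventually (a ∩ᶜ b) i (ℕₚ.≤-trans (ℕₚ.m≤m⊔n _ _) j≤i))
                     (eventually (a ∖ᶜ b) i (ℕₚ.≤-trans (ℕₚ.m≤n⊔m (time (a ∩ᶜ b)) _) j≤i)))))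
            ; content-total = content-total (ct (time ⊤ᶜ))
            }

          -- Every value of `m` is a value of some `s i`, so positivity and membership in V survive
          -- the limit.
          open Realise μ μ-hom m-content (λ a → mass-positive (s (time a)) a) (λ a → mass∈V (s (time a)) a)

          limit : FS
          limit = realisation

          converges : ∀ n i → proj₁ (stable n) ℕ.≤ i → Agree n (s i) limit
          converges n i N≤i = agree λ k k<n →
            let j = proj₁ (stable n) ℕ.⊔ time (code k)
            in ≃-trans (agreeAt (proj₂ (stable n) i j N≤i (ℕₚ.m≤m⊔n _ _)) k k<n)
                 (≃-trans (≃-sym (eventually (code k) j (ℕₚ.m≤n⊔m (proj₁ (stable n)) _)))
                   (≃-sym (mass-realisation (code k))))

      strong-complete : Complete (FullSpace V) strongMetric
      strong-complete s cauchy = L.limit , λ ε 0<ε →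
        let (n , h) = agree⇒dist< {ε} 0<ε
        in proj₁ (stable n) , λ i N≤i → h {s i} {L.limit} (L.converges n i N≤i)
        where
        stable : ∀ n → ∃[ N ] ∀ i j → N ℕ.≤ i → N ℕ.≤ j → Agree n (s i) (s j)
        stable n = let (N , h) = cauchy (fromℚ (radius n)) (0<radius n) in
          N , λ i j N≤i N≤j → agree-weaken (ℕₚ.n≤1+n n) (dist<⇒agree (s i) (s j) n (h i j N≤i N≤j))
        module L = Limit s stable

      strong-polish : Polish (strong V)
      strong-polish = strong-separable , strongMetric , strong-complete , strong⇔metric

      -- A ball inside `O k` is found around a point of `D`, then a smaller one inside `Q k` around
      -- a point of `E`. The centres of the latter form a Cauchy sequence whose limit lies in all
      -- the balls.
      module Baire {D E : Pred FS (lsuc 0ℓ)} (D-dense : Dense (strong V) D) (E-dense : Dense (strong V) E)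
        {O Q : ℕ → Pred FS (lsuc 0ℓ)} (O-open : ∀ n → AgreeOpen (O n)) (Q-open : ∀ n → AgreeOpen (Q n))
        (D⊆O : ∀ n → D ⊆ O n) (E⊆Q : ∀ n → E ⊆ Q n) where

        private
          Ball : FS → ℕ → Pred FS (lsuc 0ℓ)
          Ball x n y = Lift (lsuc 0ℓ) (Agree n x y)

          inBall : ∀ {D} → Dense (strong V) D → ∀ x n → Σ[ y ∈ FS ] (Agree n x y × y ∈ D)
          inBall {D} dense x n =
            let (y , b , y∈D) = dense (Ball x n)
                  (agree⇒strong (Ball x n) λ {y} b → n , λ {z} g → lift (agree-trans (lower b) g))
                  (x , lift (agree λ _ _ → ≃-refl))
            in y , lower b , y∈D

          Next : ℕ → FS × ℕ → Set₁
          Next k (x , n) = Σ[ (z , N) ∈ FS × ℕ ] (n ℕ.≤ N × k ℕ.< N × Agree n x z ×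
            (∀ {w} → Agree N z w → w ∈ O k × w ∈ Q k))

          next : ∀ k p → Next k p
          next k (x , n) =
            let (y , xy , y∈D) = inBall {D} D-dense x n
                (n₁ , ⊆O) = O-open k {y} (D⊆O k {y} y∈D)
                n′ = n ℕ.⊔ n₁
                (z , yz , z∈E) = inBall {E} E-dense y n′
                (n₂ , ⊆Q) = Q-open k {z} (E⊆Q k {z} z∈E)
                -- The bound `suc k` makes the radii tend to zero, so that the centres are Cauchy.
                n″ = n₂ ℕ.⊔ suc k
                n≤n′ = ℕₚ.m≤m⊔n n n₁
                n₁≤n′ = ℕₚ.m≤n⊔m n n₁
                n′≤N = ℕₚ.m≤m⊔n n′ n″
                n″≤N = ℕₚ.m≤n⊔m n′ n″
            in (z , n′ ℕ.⊔ n″) , ℕₚ.≤-trans n≤n′ n′≤N , ℕₚ.≤-trans (ℕₚ.m≤n⊔m n₂ (suc k)) n″≤N ,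
               agree-trans xy (agree-weaken n≤n′ yz) ,
               λ {w} zw →
                 ⊆O {w} (agree-weaken n₁≤n′ (agree-trans yz (agree-weaken n′≤N zw))) ,
                 ⊆Q {w} (agree-weaken (ℕₚ.≤-trans (ℕₚ.m≤m⊔n n₂ (suc k)) n″≤N) zw)

          state : ℕ → FS × ℕ
          state zero    = μ , 0
          state (suc k) = proj₁ (next k (state k))

          x : ℕ → FS
          x k = proj₁ (state k)

          N : ℕ → ℕ
          N k = proj₂ (state k)

          k≤N : ∀ k → k ℕ.≤ N k
          k≤N zero    = ℕ.z≤n
          k≤N (suc k) = proj₁ (proj₂ (proj₂ (next k (state k))))

          later : ∀ k d → Agree (N k) (x k) (x (d ℕ.+ k)) × N k ℕ.≤ N (d ℕ.+ k)
          later k zero = (agree λ _ _ → ≃-refl) , ℕₚ.≤-refl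
          later k (suc d) =
            let (h , le) = later k d
                (_ , le′ , _ , h′ , _) = next (d ℕ.+ k) (state (d ℕ.+ k))
            in agree-trans h
                 (agree-weaken le h′) , ℕₚ.≤-trans le le′

          settled : ∀ {k i} → k ℕ.≤ i → Agree (N k) (x k) (x i)
          settled {k} {i} k≤i = subst (λ i → Agree (N k) (x k) (x i)) (ℕₚ.m∸n+n≡m k≤i) (proj₁ (later k (i ℕ.∸ k)))

          stable : ∀ n → ∃[ M ] ∀ i j → M ℕ.≤ i → M ℕ.≤ j → Agree n (x i) (x j)
          stable n = n , λ i j n≤i n≤j → agree-trans 
            (agree-sym (agree-weaken (k≤N n) (settled n≤i)))
            (agree-weaken (k≤N n) (settled n≤j))

          module L = Limit x stable

          limit-agrees : ∀ k → Agree (N k) (x k) L.limit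
          limit-agrees k = agree-trans (settled (ℕₚ.m≤m⊔n k _))
            (L.converges (N k) i (ℕₚ.m≤n⊔m k _))
            where i = k ℕ.⊔ proj₁ (stable (N k))

        baire : Σ[ ν ∈ FS ] (∀ n → ν ∈ O n × ν ∈ Q n)
        baire = L.limit , λ n →
          proj₂ (proj₂ (proj₂ (proj₂ (next n (state n))))) {L.limit} (limit-agrees (suc n))

  -- Borel complexity

  module _ (v : ℝ) (a : Cl) where

    private
      Above Below Apart : Pred ProbabilityMeasure (lsuc 0ℓ)
      Above ν = Lift _ (v ≺ mass ν a)
      Below ν = Lift _ (mass ν a ≺ v)
      Apart ν = Lift _ (¬ (mass ν a ≃ v))

    above-open : Topology.Open weak* Above
    above-open {ν} (lift lt) =
      let (ε , 0<ε , h) = ≺-nearʳ {v} {mass ν a} lt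
      in (⟦ a ⟧ , ε , 0<ε) ∷ [] , λ { {ρ} (e ∷ []) → lift (h {mass ρ a} e) }

    below-open : Topology.Open weak* Below
    below-open {ν} (lift lt) =
      let (ε , 0<ε , h) = ≺-nearˡ {v} {mass ν a} lt
      in (⟦ a ⟧ , ε , 0<ε) ∷ [] , λ { {ρ} (e ∷ []) → lift (h {mass ρ a} e) }

    apart-open : Topology.Open weak* Apart
    apart-open {ν} (lift ν≄) = split (compareℝ (mass ν a) v)
      where
      split : mass ν a ≺ v ⊎ mass ν a ≃ v ⊎ v ≺ mass ν a → ∃[ i ] _
      split (inj₁ lt) = let (i , h) = below-open {ν} (lift lt) in
        i , λ {ρ} e → lift λ eq → ≺-irrefl eq (lower (h {ρ} e))
      split (inj₂ (inj₁ eq)) = ⊥-elim (ν≄ eq)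
      split (inj₂ (inj₂ gt)) = let (i , h) = above-open {ν} (lift gt) in
        i , λ {ρ} e → lift λ eq → ≺-irrefl (≃-sym eq) (lower (h {ρ} e))

  module Complexity (V : Pred ℝ 0ℓ) (groupLike : GroupLike V) where

    open Strong V groupLike

    private
      -- Positivity of a mass is not a weak* closed condition. Stated for the constant `enum n` it
      -- no longer involves `ν`, so it can be joined to the closed condition on the value.
      HasValue : ℕ → ℕ → Pred ProbabilityMeasure (lsuc 0ℓ)
      HasValue k n ν = Lift _ (mass ν (code k) ≃ enum n × (Nonempty (code k) → 0ℝ ≺ enum n))

      hasValue-closed : ∀ k n → Closed weak* (HasValue k n)
      hasValue-closed k n {ν} ∉C with em {P = Nonempty (code k) → 0ℝ ≺ enum n}
      ... | no ¬pos = [] , λ _ (lift (_ , pos)) → ¬pos pos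
      ... | yes pos =
        let (i , h) = apart-open (enum n) (code k) {ν} (lift λ e → ∉C (lift (e , pos)))
        in i , λ {ρ} r (lift (e , _)) → lower (h {ρ} r) e

      full⇒values : ∀ {ν} → Full V ν → ∀ k → ∃[ n ] HasValue k n ν
      full⇒values {ν} f k =
        let (n , e) = proj₁ enum-range (mass∈V (ν , f) (code k))
        in n , lift (≈⇒≃ e , λ h → ≺-respʳ (≈⇒≃ e) (mass-positive (ν , f) (code k) h))

      values⇒full : ∀ {ν} → (∀ k → ∃[ n ] HasValue k n ν) → Full V ν
      values⇒full {ν} h = (λ {U} → positive⇒full ν positive {U}) , λ {r} (U , r≈U) →
        let (k , c) = code-surjective (fromClopen U)
            (n , lift (e , _)) = h k
        in proj₂ enum-range (n , ≃⇒≈ (≃-trans (≈⇒≃ {r} {ν ⟨ U ⟩} r≈U) (≃-trans (value-mass ν U)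
             (≃-trans (≃-sym (content-cong (mass-content ν) c)) e))))
        where
        positive : Positive (mass ν)
        positive a (x , x∈a) =
          let (k , c) = code-surjective a
              (n , lift (e , pos)) = h k
          in ≺-respʳ (≃-trans (≃-sym e) (content-cong (mass-content ν) c)) (pos (x , trans (c x) x∈a))

    full-Fσδ : Fσδ weak* (Full V)
    full-Fσδ = HasValue , (λ k n {ν} → hasValue-closed k n {ν}) ,
      (λ {ν} → full⇒values {ν}) , (λ {ν} → values⇒full {ν})

    -- H is the set of the ν with ∀ j → ∃ n → Fills j n ν. Each Fills j n is weak*
    -- closed and each ∃ n → Fills j n ν is strongly open.
    record Fills (j n : ℕ) (ν : ProbabilityMeasure) : Set₁ where
      constructor fills
      w = code (proj₁ (unpair j))
      v = enum (proj₂ (unpair j))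
      field filled : ¬ (v ≺ mass ν w) ⊎ (code n ⊑ w × mass ν (code n) ≃ v)

    homogeneous⇒fills : ∀ ν → Homogeneous (mass ν) → ∀ j → ∃[ n ] Fills j n ν
    homogeneous⇒fills ν hom j with em {P = enum (proj₂ (unpair j)) ≺ mass ν (code (proj₁ (unpair j)))}
    -- Any index would do, as the first alternative does not mention `code n`.
    ... | no ⊀  = 0 , fills (inj₁ ⊀)
    ... | yes ≺ =
      let v∈V = proj₂ enum-range (proj₂ (unpair j) , ≈-refl (enum (proj₂ (unpair j))))
          (w′ , w′⊑w , e) = hom (code (proj₁ (unpair j))) v∈V ≺
          (n , c) = code-surjective w′
      in n , fills (inj₂ ((λ x h → w′⊑w x (trans (sym (c x)) h)) , ≃-trans (content-cong (mass-content ν) c) e))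

    fills⇒homogeneous : ∀ ν → (∀ j → ∃[ n ] Fills j n ν) → Homogeneous (mass ν)
    fills⇒homogeneous ν h w {v} v∈V v≺w =
      let (k , c) = code-surjective w
          (i , v≈) = proj₁ enum-range v∈V
          (j , e) = unpair-surjective k i
          (n , fills f) = h j
      in extract k c i v≈ j e n f
      where
      extract : ∀ k → code k ≗ᶜ w → ∀ i → v ≈ enum i → ∀ j → unpair j ≡ (k , i) → ∀ n →
        ¬ (enum (proj₂ (unpair j)) ≺ mass ν (code (proj₁ (unpair j)))) ⊎
          (code n ⊑ code (proj₁ (unpair j)) × mass ν (code n) ≃ enum (proj₂ (unpair j))) →
        Σ[ w′ ∈ Cl ] (w′ ⊑ w × mass ν w′ ≃ v)
      extract k c i v≈ j e n f rewrite e with f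
      ... | inj₁ ⊀ = ⊥-elim (⊀ (≺-respʳ (≃-sym (content-cong (mass-content ν) c)) (≺-respˡ (≈⇒≃ v≈) v≺w)))
      ... | inj₂ (n⊑k , eq) = code n , (λ x h → trans (sym (c x)) (n⊑k x h)) , ≃-trans eq (≃-sym (≈⇒≃ v≈))

    private
      fills-closed : ∀ j n → Closed weak* (Fills j n)
      -- The inclusion does not depend on the measure, so it is decided beforehand; what remains is
      -- a union of at most two closed conditions.
      fills-closed j n {ν} ∉C with em {P = code n ⊑ code (proj₁ (unpair j))}
      ... | no ⋢ =
        let (i , h) = above-open v w {ν} (lift (byContradiction λ ⊀ → ∉C (fills (inj₁ ⊀))))
        in i , λ {ρ} r → λ { (fills (inj₁ ⊀)) → ⊀ (lower (h {ρ} r)) ; (fills (inj₂ (⊑w , _))) → ⋢ ⊑w }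
        where
        w = code (proj₁ (unpair j))
        v = enum (proj₂ (unpair j))
      ... | yes ⊑w =
        let (i , h) = above-open v w {ν} (lift (byContradiction λ ⊀ → ∉C (fills (inj₁ ⊀))))
            (i′ , h′) = apart-open v (code n) {ν} (lift λ e → ∉C (fills (inj₂ (⊑w , e))))
        in i ++ i′ , λ {ρ} r → λ { (fills (inj₁ ⊀)) → ⊀ (lower (h {ρ} (++⁻ˡ i r)))
                                 ; (fills (inj₂ (_ , e))) → lower (h′ {ρ} (++⁻ʳ i r)) e }
        where
        w = code (proj₁ (unpair j))
        v = enum (proj₂ (unpair j))

    fills-agree : ∀ j n {μ ν : FS} → Agree (suc (proj₁ (unpair j) ℕ.⊔ n)) μ ν →
      Fills j n (proj₁ μ) → Fills j n (proj₁ ν)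
    fills-agree j n {μ} {ν} g (fills (inj₁ ⊀)) = fills (inj₁ λ lt → ⊀ (≺-respʳ
      (≃-sym (agreeAt g (proj₁ (unpair j)) (ℕ.s≤s (ℕₚ.m≤m⊔n _ n)))) lt))
      where open Agree
    fills-agree j n {μ} {ν} g (fills (inj₂ (n⊑w , e))) = fills (inj₂ (n⊑w ,
      ≃-trans (≃-sym (agreeAt g n (ℕ.s≤s (ℕₚ.m≤n⊔m (proj₁ (unpair j)) n)))) e))
      where open Agree

    module _ (μ : FS) (μ-hom : Homogeneous (massᶠ μ)) where

      private
        H : Pred FS (lsuc 0ℓ)
        H = conjugacyClass V μ

        H⇒fills : H ⊆ λ ν → ∀ j → ∃[ n ] Fills j n (proj₁ ν)
        H⇒fills {ν} ν∈H = homogeneous⇒fills (proj₁ ν) (conjugate⇒homogeneous μ ν μ-hom ν∈H)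

        fills⇒H : (λ ν → ∀ j → ∃[ n ] Fills j n (proj₁ ν)) ⊆ H
        fills⇒H {ν} f = homogeneous⇒conjugate μ ν μ-hom (fills⇒homogeneous (proj₁ ν) f)

      class-Fσδ : Fσδ (weak*Full V) H
      class-Fσδ = (λ j n ν → Fills j n (proj₁ ν)) ,
        (λ j n → ∁ (Fills j n) , (λ {ν} → fills-closed j n {ν}) , (λ {ν} ν∉ → ν∉) , (λ {ν} ν∉ → ν∉)) ,
        (λ {ν} → H⇒fills {ν}) , (λ {ν} → fills⇒H {ν})

      class-Gδ : Gδ (strong V) H
      class-Gδ = O , (λ j {ν} → agree⇒strong (O j) (λ {ρ} → O-open j {ρ}) {ν}) ,
        (λ {ν} → H⇒fills {ν}) , (λ {ν} → fills⇒H {ν})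
        where
        O : ℕ → Pred FS (lsuc 0ℓ)
        O j ν = ∃[ n ] Fills j n (proj₁ ν)
        O-open : ∀ j → AgreeOpen (O j)
        O-open j {ν} (n , f) = suc (proj₁ (unpair j) ℕ.⊔ n) , λ {ρ} g → n , fills-agree j n {ν} {ρ} g f

      class-dense : Dense (strong V) H
      class-dense O o (ν , ν∈O) =
        let (n , h) = strong⇒agree O o {ν} ν∈O
            -- `code k` depends on the first `modulus k` coordinates, so this level resolves the
            -- first `n` codes together.
            (ho , e) = approximate μ μ-hom ν (maximum modulus n)
        in act V ho μ , h {act V ho μ} (agree λ k k<n → ≃-sym (e (code k) λ x y r →
             evaluate-uniform (modulus k) _ x y (≈[]-weaken (≤maximum modulus k<n) r))) ,
           ho , λ {B} b → ≈-refl (measure (proj₁ (act V ho μ)) b)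
        where
        modulus : ℕ → ℕ
        modulus k = proj₁ (unpair k)

      class-weak*-dense : Dense (weak*Full V) H
      class-weak*-dense O o = class-dense O (strong-finer O o)

      private
        conjugate-sym : ∀ {ν ρ} → ρ ∈ conjugacyClass V ν → ν ∈ conjugacyClass V ρ
        conjugate-sym {ν} {ρ} (h , e) = inverseHomeo h , same-mass⇒~ {ν} {act V (inverseHomeo h) ρ} λ a →
          ≃-sym (≃-trans (mass-⋆ (inverseHomeo h) (proj₁ ρ) d a)
            (≃-trans (~⇒same-mass {ρ} {act V h ν} e (pullback d a))
              (≃-trans (mass-⋆ h (proj₁ ν) c (pullback d a))
                (content-cong (mass-content (proj₁ ν)) λ x → χ-resp a (Inverse.strictlyInverseʳ inverse x)))))
          where
          open Homeo h
          c : PointwiseContinuous to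
          c = continuous⇒pointwise to-continuous
          d : PointwiseContinuous from
          d = continuous⇒pointwise from-continuous

      class-unique : ∀ ν → Dense (strong V) (conjugacyClass V ν) → Gδ (strong V) (conjugacyClass V ν) →
        conjugacyClass V ν ≐ H
      class-unique ν ν-dense (Q , Q-open , ν⊆Q , Q⊆ν) =
        (λ {ρ} ρ∈ν → homogeneous⇒conjugate μ ρ μ-hom (conjugate⇒homogeneous ν ρ ν-hom ρ∈ν)) ,
        (λ {ρ} ρ∈H → homogeneous⇒conjugate ν ρ ν-hom (conjugate⇒homogeneous μ ρ μ-hom ρ∈H))
        where
        O = proj₁ class-Gδ
        O-open = proj₁ (proj₂ class-Gδ)
        open Baire μ μ-hom {H} {conjugacyClass V ν} class-dense ν-dense {O} {Q}
          (λ n → strong⇒agree (O n) (λ {ρ} → O-open n {ρ})) (λ n → strong⇒agree (Q n) (λ {ρ} → Q-open n {ρ}))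
          (λ n {ρ} ρ∈H → H⇒fills {ρ} ρ∈H n) (λ n {ρ} ρ∈ν → ν⊆Q {ρ} ρ∈ν n)
        ρ : FS
        ρ = proj₁ baire
        ρ∈H : ρ ∈ H
        ρ∈H = fills⇒H {ρ} λ n → proj₁ (proj₂ baire n)
        ρ∈ν : ρ ∈ conjugacyClass V ν
        ρ∈ν = Q⊆ν {ρ} λ n → proj₂ (proj₂ baire n)
        -- The common point `ρ` is conjugate to `μ`, hence homogeneous, and conjugacy passes this on
        -- to `ν`.
        ν-hom : Homogeneous (massᶠ ν)
        ν-hom = conjugate⇒homogeneous ρ ν (conjugate⇒homogeneous μ ρ μ-hom ρ∈H) (conjugate-sym {ν} {ρ} ρ∈ν)

proposition3p7 : (∀ {ℓ} → ExcludedMiddle ℓ) →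
    (V : Pred ℝ 0ℓ) → GroupLike V →
    (μ : ProbabilityMeasure) (μ-good : IsGood μ) (values : clopenValues μ ≐ V) →
    let H = conjugacyClass V (μ , IsGood.full μ-good , proj₁ values) in
    (Polish (strong V) × strong V FinerThan weak*Full V) ×
    Fσδ weak* (Full V) ×
    (Dense (weak*Full V) H × Fσδ (weak*Full V) H) ×
    (Dense (strong V) H × Gδ (strong V) H ×
    (∀ ν → Dense (strong V) (conjugacyClass V ν) → Gδ (strong V) (conjugacyClass V ν) →
    conjugacyClass V ν ≐ H))
proposition3p7 em V groupLike μ μ-good values =
  (S.strong-polish ν hom , S.strong-finer) ,
  C.full-Fσδ ,
  (C.class-weak*-dense ν hom , C.class-Fσδ ν hom) ,
  (C.class-dense ν hom , C.class-Gδ ν hom , C.class-unique ν hom)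
  where
  open Classical em
  module S = Strong V groupLike
  module C = Complexity V groupLike
  ν : S.FS
  ν = μ , IsGood.full μ-good , proj₁ values
  hom : S.Homogeneous (S.massᶠ ν)
  hom = S.good⇒homogeneous μ-good values
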